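{- Let $m\ge 1$ and let $\mathbf a=(a_1,\dots,a_m)$ be an admissible sequence. For a nonnegative integer $x$ define the $m\times m$ matrices $$\mathbf m(\mathbf a,x)=\left(\frac{(q^{2i+2x};q^2)_{a_j+1-2i}}{(q;q)_{a_j+1-2i}}\right)_{i,j=1}^m,\qquad \mathbf s(\mathbf a)=\left(\frac{1}{(q;q)_{a_j+1-2i}}\right)_{i,j=1}^m,$$ where in both matrices the $(i,j)$-entry is defined to be $0$ whenever $a_j+1-2i<0$. Then, as an identity of rational functions in $q$, $$\det \mathbf m(\mathbf a,x)=\left(\prod_{k=1}^m (q^{2x+2k};q)_{a_k-2k+1}\right)\det \mathbf s(\mathbf a).$$
   Context: $q$ is an indeterminate. For integers $n\ge 0$, $(a;q)_n=\prod_{j=0}^{n-1}(1-aq^j)$ (so $(a;q)_0=1$). A finite sequence of integers $\mathbf a=(a_1,\dots,a_m)$ is called admissible if it is strictly increasing and $2i-1\le a_i\le 2m$ for all $1\le i\le m$. -}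

module Defs where

open import Algebra.Bundles using (CommutativeRing; Semiring)
import Algebra.Definitions.RawSemiring as RawSemiringDefs
import Algebra.Properties.Ring as RingProperties
import Algebra.Solver.Ring.NaturalCoefficients.Default as NatCoeffSolver
open import Data.Empty using (⊥-elim)
open import Data.Fin.Base as Fin using (Fin; toℕ; punchIn)
open import Data.Integer.Base as ℤ using (ℤ; +_; -[1+_]; 0ℤ; 1ℤ)
import Data.Integer.Properties as ℤₚ
open import Data.List.Base using (List; []; _∷_; map)
open import Data.Nat.Base as ℕ using (ℕ; zero; suc)
open import Data.Product.Base using (_,_)
open import Data.Sum.Base using (_⊎_; inj₁; inj₂)
open import Data.Vec.Functional as Vector using (Vector)
open import Level using (Level; _⊔_; 0ℓ)
open import Relation.Binary.Bundles using (Setoid)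
open import Relation.Binary.PropositionalEquality
  using (_≡_; refl; sym; trans; cong; cong₂)
import Relation.Binary.Reasoning.Setoid as SetoidReasoning
open import Relation.Nullary using (¬_; yes; no)

private
  variable
    c ℓ : Level

module RingDefs (R : CommutativeRing c ℓ) where

  open CommutativeRing R
  open Semiring semiring using (rawSemiring)
  open RawSemiringDefs rawSemiring public using (_^_; sum; product)

  Matrix : ℕ → Set c
  Matrix n = Vector (Vector Carrier n) n

  -- Laplace expansion along the first row.
  det : ∀ {n} → Matrix n → Carrier
  det {zero}  A = 1#
  det {suc n} A = sum λ (j : Fin (suc n)) →
    (- 1#) ^ toℕ j * (A Fin.zero j * det (λ i k → A (Fin.suc i) (punchIn j k)))

  -- poch a b n = (a; b)ₙ = ∏_{0 ≤ j < n} (1 - a bʲ)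
  poch : Carrier → Carrier → ℕ → Carrier
  poch a b n = product λ (j : Fin n) → 1# - a * b ^ toℕ j

module Polynomials where

  -- Coefficients in increasing degree; trailing zeros are allowed, so
  -- equality is equality of all coefficients.
  Poly : Set
  Poly = List ℤ

  coeff : Poly → ℕ → ℤ
  coeff []      _       = 0ℤ
  coeff (a ∷ p) zero    = a
  coeff (a ∷ p) (suc n) = coeff p n

  infix 4 _≈_
  record _≈_ (p r : Poly) : Set where
    constructor mk≈
    field
      at : ∀ n → coeff p n ≡ coeff r n
  open _≈_ public

  infixl 6 _+_
  _+_ : Poly → Poly → Poly
  []      + r       = r
  (a ∷ p) + []      = a ∷ p
  (a ∷ p) + (b ∷ r) = a ℤ.+ b ∷ p + r

  scale : ℤ → Poly → Poly
  scale a = map (a ℤ.*_)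

  infixl 7 _*_
  _*_ : Poly → Poly → Poly
  []      * r = []
  (a ∷ p) * r = scale a r + (0ℤ ∷ p * r)

  -_ : Poly → Poly
  -_ = map (λ a → ℤ.- a)

  0ₚ 1ₚ : Poly
  0ₚ = []
  1ₚ = 1ℤ ∷ []

  coeff-+ : ∀ p r n → coeff (p + r) n ≡ coeff p n ℤ.+ coeff r n
  coeff-+ []      r       n       = sym (ℤₚ.+-identityˡ _)
  coeff-+ (a ∷ p) []      n       = sym (ℤₚ.+-identityʳ _)
  coeff-+ (a ∷ p) (b ∷ r) zero    = refl
  coeff-+ (a ∷ p) (b ∷ r) (suc n) = coeff-+ p r n

  coeff-scale : ∀ a p n → coeff (scale a p) n ≡ a ℤ.* coeff p n
  coeff-scale a []      n       = sym (ℤₚ.*-zeroʳ a)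
  coeff-scale a (b ∷ p) zero    = refl
  coeff-scale a (b ∷ p) (suc n) = coeff-scale a p n

  coeff-neg : ∀ p n → coeff (- p) n ≡ ℤ.- coeff p n
  coeff-neg []      n       = refl
  coeff-neg (b ∷ p) zero    = refl
  coeff-neg (b ∷ p) (suc n) = coeff-neg p n

  ≈-refl : ∀ {p} → p ≈ p
  ≈-refl = mk≈ λ _ → refl

  ≈-sym : ∀ {p r} → p ≈ r → r ≈ p
  ≈-sym e = mk≈ λ n → sym (at e n)

  ≈-trans : ∀ {p r s} → p ≈ r → r ≈ s → p ≈ s
  ≈-trans e f = mk≈ λ n → trans (at e n) (at f n)

  ≈-setoid : Setoid 0ℓ 0ℓ
  ≈-setoid = record
    { Carrier = Poly ; _≈_ = _≈_
    ; isEquivalence = record { refl = ≈-refl ; sym = ≈-sym ; trans = ≈-trans } }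

  open SetoidReasoning ≈-setoid

  ∷-cong : ∀ {a b p r} → a ≡ b → p ≈ r → (a ∷ p) ≈ (b ∷ r)
  ∷-cong e f = mk≈ λ { zero → e ; (suc n) → at f n }

  0∷[]≈[] : (0ℤ ∷ []) ≈ []
  0∷[]≈[] = mk≈ λ { zero → refl ; (suc n) → refl }

  +-cong : ∀ {p p′ r r′} → p ≈ p′ → r ≈ r′ → p + r ≈ p′ + r′
  +-cong {p} {p′} {r} {r′} e f = mk≈ λ n →
    trans (coeff-+ p r n)
      (trans (cong₂ ℤ._+_ (at e n) (at f n)) (sym (coeff-+ p′ r′ n)))

  +-assoc : ∀ p r s → (p + r) + s ≈ p + (r + s)
  +-assoc p r s = mk≈ λ n →
    trans (coeff-+ (p + r) s n) (trans (cong (ℤ._+ coeff s n) (coeff-+ p r n))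
      (trans (ℤₚ.+-assoc (coeff p n) _ _)
        (sym (trans (coeff-+ p (r + s) n) (cong (λ z → coeff p n ℤ.+ z) (coeff-+ r s n))))))

  +-comm : ∀ p r → p + r ≈ r + p
  +-comm p r = mk≈ λ n →
    trans (coeff-+ p r n) (trans (ℤₚ.+-comm (coeff p n) _) (sym (coeff-+ r p n)))

  +-identityˡ : ∀ p → 0ₚ + p ≈ p
  +-identityˡ p = ≈-refl

  +-identityʳ : ∀ p → p + 0ₚ ≈ p
  +-identityʳ p = +-comm p 0ₚ

  neg-cong : ∀ {p r} → p ≈ r → - p ≈ - r
  neg-cong {p} {r} e = mk≈ λ n →
    trans (coeff-neg p n) (trans (cong (λ a → ℤ.- a) (at e n)) (sym (coeff-neg r n)))

  neg-inverseˡ : ∀ p → (- p) + p ≈ 0ₚ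
  neg-inverseˡ p = mk≈ λ n →
    trans (coeff-+ (- p) p n) (trans (cong (ℤ._+ coeff p n) (coeff-neg p n))
      (ℤₚ.+-inverseˡ (coeff p n)))

  neg-inverseʳ : ∀ p → p + (- p) ≈ 0ₚ
  neg-inverseʳ p = ≈-trans (+-comm p (- p)) (neg-inverseˡ p)

  +-interchange : ∀ p r s t → (p + r) + (s + t) ≈ (p + s) + (r + t)
  +-interchange p r s t = begin
    (p + r) + (s + t)  ≈⟨ +-assoc p r (s + t) ⟩
    p + (r + (s + t))  ≈⟨ +-cong (≈-refl {p}) (≈-sym (+-assoc r s t)) ⟩
    p + ((r + s) + t)  ≈⟨ +-cong (≈-refl {p}) (+-cong (+-comm r s) (≈-refl {t})) ⟩
    p + ((s + r) + t)  ≈⟨ +-cong (≈-refl {p}) (+-assoc s r t) ⟩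
    p + (s + (r + t))  ≈⟨ ≈-sym (+-assoc p s (r + t)) ⟩
    (p + s) + (r + t)  ∎

  scale-cong : ∀ a {p r} → p ≈ r → scale a p ≈ scale a r
  scale-cong a {p} {r} e = mk≈ λ n →
    trans (coeff-scale a p n) (trans (cong (a ℤ.*_) (at e n)) (sym (coeff-scale a r n)))

  scale-+ : ∀ a p r → scale a (p + r) ≈ scale a p + scale a r
  scale-+ a p r = mk≈ λ n →
    trans (coeff-scale a (p + r) n) (trans (cong (a ℤ.*_) (coeff-+ p r n))
      (trans (ℤₚ.*-distribˡ-+ a _ _)
        (sym (trans (coeff-+ (scale a p) (scale a r) n)
          (cong₂ ℤ._+_ (coeff-scale a p n) (coeff-scale a r n))))))

  +-scale : ∀ a b p → scale (a ℤ.+ b) p ≈ scale a p + scale b p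
  +-scale a b p = mk≈ λ n →
    trans (coeff-scale (a ℤ.+ b) p n) (trans (ℤₚ.*-distribʳ-+ (coeff p n) a b)
      (sym (trans (coeff-+ (scale a p) (scale b p) n)
        (cong₂ ℤ._+_ (coeff-scale a p n) (coeff-scale b p n)))))

  scale-scale : ∀ a b p → scale (a ℤ.* b) p ≈ scale a (scale b p)
  scale-scale a b p = mk≈ λ n →
    trans (coeff-scale (a ℤ.* b) p n) (trans (ℤₚ.*-assoc a b _)
      (sym (trans (coeff-scale a (scale b p) n) (cong (a ℤ.*_) (coeff-scale b p n)))))

  scale-0 : ∀ p → scale 0ℤ p ≈ 0ₚ
  scale-0 p = mk≈ (coeff-scale 0ℤ p)

  scale-1 : ∀ p → scale 1ℤ p ≈ p
  scale-1 p = mk≈ λ n → trans (coeff-scale 1ℤ p n) (ℤₚ.*-identityˡ _)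

  *-congˡ : ∀ p {r s} → r ≈ s → p * r ≈ p * s
  *-congˡ []      e = ≈-refl
  *-congˡ (a ∷ p) e = +-cong (scale-cong a e) (∷-cong refl (*-congˡ p e))

  *-zeroʳ : ∀ p → p * [] ≈ []
  *-zeroʳ []      = ≈-refl
  *-zeroʳ (a ∷ p) = ≈-trans (∷-cong refl (*-zeroʳ p)) 0∷[]≈[]

  *-∷ : ∀ p b r → p * (b ∷ r) ≈ scale b p + (0ℤ ∷ p * r)
  *-∷ []      b r = ≈-sym 0∷[]≈[]
  *-∷ (a ∷ p) b r = ∷-cong (cong (ℤ._+ 0ℤ) (ℤₚ.*-comm a b)) (begin
    scale a r + p * (b ∷ r)                  ≈⟨ +-cong ≈-refl (*-∷ p b r) ⟩
    scale a r + (scale b p + (0ℤ ∷ p * r))   ≈⟨ ≈-sym (+-assoc (scale a r) _ _) ⟩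
    (scale a r + scale b p) + (0ℤ ∷ p * r)   ≈⟨ +-cong (+-comm (scale a r) _) ≈-refl ⟩
    (scale b p + scale a r) + (0ℤ ∷ p * r)   ≈⟨ +-assoc (scale b p) _ _ ⟩
    scale b p + (scale a r + (0ℤ ∷ p * r))   ∎)

  *-comm : ∀ p r → p * r ≈ r * p
  *-comm []      r = ≈-sym (*-zeroʳ r)
  *-comm (a ∷ p) r = begin
    scale a r + (0ℤ ∷ p * r)  ≈⟨ +-cong ≈-refl (∷-cong refl (*-comm p r)) ⟩
    scale a r + (0ℤ ∷ r * p)  ≈⟨ ≈-sym (*-∷ r a p) ⟩
    r * (a ∷ p)               ∎

  *-cong : ∀ {p p′ r r′} → p ≈ p′ → r ≈ r′ → p * r ≈ p′ * r′
  *-cong {p} {p′} {r} {r′} e f = begin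
    p * r    ≈⟨ *-congˡ p f ⟩
    p * r′   ≈⟨ *-comm p r′ ⟩
    r′ * p   ≈⟨ *-congˡ r′ e ⟩
    r′ * p′  ≈⟨ *-comm r′ p′ ⟩
    p′ * r′  ∎

  *-distribˡ-+ : ∀ p r s → p * (r + s) ≈ p * r + p * s
  *-distribˡ-+ []      r s = ≈-refl
  *-distribˡ-+ (a ∷ p) r s = begin
    scale a (r + s) + (0ℤ ∷ p * (r + s))
      ≈⟨ +-cong (scale-+ a r s) (∷-cong refl (*-distribˡ-+ p r s)) ⟩
    (scale a r + scale a s) + ((0ℤ ∷ p * r) + (0ℤ ∷ p * s))
      ≈⟨ +-interchange (scale a r) _ _ _ ⟩
    (scale a r + (0ℤ ∷ p * r)) + (scale a s + (0ℤ ∷ p * s)) ∎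

  *-distribʳ-+ : ∀ p r s → (r + s) * p ≈ r * p + s * p
  *-distribʳ-+ p r s = begin
    (r + s) * p    ≈⟨ *-comm (r + s) p ⟩
    p * (r + s)    ≈⟨ *-distribˡ-+ p r s ⟩
    p * r + p * s  ≈⟨ +-cong (*-comm p r) (*-comm p s) ⟩
    r * p + s * p  ∎

  scale-* : ∀ a p r → scale a p * r ≈ scale a (p * r)
  scale-* a []      r = ≈-refl
  scale-* a (b ∷ p) r = begin
    scale (a ℤ.* b) r + (0ℤ ∷ scale a p * r)
      ≈⟨ +-cong (scale-scale a b r)
                (∷-cong (sym (ℤₚ.*-zeroʳ a)) (scale-* a p r)) ⟩
    scale a (scale b r) + scale a (0ℤ ∷ p * r)
      ≈⟨ ≈-sym (scale-+ a (scale b r) _) ⟩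
    scale a (scale b r + (0ℤ ∷ p * r)) ∎

  0∷-* : ∀ p r → (0ℤ ∷ p) * r ≈ 0ℤ ∷ p * r
  0∷-* p r = +-cong (scale-0 r) ≈-refl

  *-assoc : ∀ p r s → (p * r) * s ≈ p * (r * s)
  *-assoc []      r s = ≈-refl
  *-assoc (a ∷ p) r s = begin
    (scale a r + (0ℤ ∷ p * r)) * s        ≈⟨ *-distribʳ-+ s (scale a r) _ ⟩
    scale a r * s + (0ℤ ∷ p * r) * s      ≈⟨ +-cong (scale-* a r s) (0∷-* (p * r) s) ⟩
    scale a (r * s) + (0ℤ ∷ (p * r) * s)  ≈⟨ +-cong ≈-refl (∷-cong refl (*-assoc p r s)) ⟩
    scale a (r * s) + (0ℤ ∷ p * (r * s))  ∎

  *-identityˡ : ∀ p → 1ₚ * p ≈ p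
  *-identityˡ p = begin
    scale 1ℤ p + (0ℤ ∷ [])  ≈⟨ +-cong (scale-1 p) 0∷[]≈[] ⟩
    p + []                  ≈⟨ +-identityʳ p ⟩
    p                       ∎

  *-identityʳ : ∀ p → p * 1ₚ ≈ p
  *-identityʳ p = ≈-trans (*-comm p 1ₚ) (*-identityˡ p)

  commutativeRing : CommutativeRing 0ℓ 0ℓ
  commutativeRing = record
    { Carrier = Poly ; _≈_ = _≈_ ; _+_ = _+_ ; _*_ = _*_ ; -_ = -_ ; 0# = 0ₚ ; 1# = 1ₚ
    ; isCommutativeRing = record
      { isRing = record
        { +-isAbelianGroup = record
          { isGroup = record
            { isMonoid = record
              { isSemigroup = record
                { isMagma = record
                  { isEquivalence = Setoid.isEquivalence ≈-setoid ; ∙-cong = +-cong }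
                ; assoc = +-assoc }
              ; identity = +-identityˡ , +-identityʳ }
            ; inverse = neg-inverseˡ , neg-inverseʳ
            ; ⁻¹-cong = neg-cong }
          ; comm = +-comm }
        ; *-cong = *-cong
        ; *-assoc = *-assoc
        ; *-identity = *-identityˡ , *-identityʳ
        ; distrib = *-distribˡ-+ , *-distribʳ-+ }
      ; *-comm = *-comm }
    }

  coeff₀-* : ∀ p r → coeff (p * r) 0 ≡ coeff p 0 ℤ.* coeff r 0
  coeff₀-* []      r = refl
  coeff₀-* (a ∷ p) r =
    trans (coeff-+ (scale a r) (0ℤ ∷ p * r) 0)
      (trans (ℤₚ.+-identityʳ _) (coeff-scale a r 0))

  1≉0 : ¬ (1ₚ ≈ 0ₚ)
  1≉0 e with at e 0
  ... | ()

  cancel-∷ : ∀ {a p} → (a ∷ p) ≈ 0ₚ → p ≈ 0ₚ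
  cancel-∷ e = mk≈ λ n → at e (suc n)

  ≈0-∷ : ∀ {a p} → a ≡ 0ℤ → p ≈ 0ₚ → (a ∷ p) ≈ 0ₚ
  ≈0-∷ e f = mk≈ λ { zero → e ; (suc n) → at f n }

  integral-head : ∀ a p → ¬ (a ≡ 0ℤ) → ∀ r → (a ∷ p) * r ≈ 0ₚ → r ≈ 0ₚ
  integral-head a p a≢0 []      e = ≈-refl
  integral-head a p a≢0 (b ∷ r) e =
    ≈0-∷ b≡0 (integral-head a p a≢0 r (cancel-∷ (begin
      0ℤ ∷ (a ∷ p) * r                     ≈⟨ ≈-refl ⟩
      [] + (0ℤ ∷ (a ∷ p) * r)              ≈⟨ +-cong (≈-sym (scale-0 (a ∷ p))) ≈-refl ⟩
      scale 0ℤ (a ∷ p) + (0ℤ ∷ (a ∷ p) * r) ≈⟨ ≈-sym (*-∷ (a ∷ p) 0ℤ r) ⟩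
      (a ∷ p) * (0ℤ ∷ r)                   ≈⟨ *-congˡ (a ∷ p) (∷-cong (sym b≡0) ≈-refl) ⟩
      (a ∷ p) * (b ∷ r)                    ≈⟨ e ⟩
      []                                   ∎)))
    where
    b≡0 : b ≡ 0ℤ
    b≡0 with ℤₚ.i*j≡0⇒i≡0∨j≡0 a (trans (sym (coeff₀-* (a ∷ p) (b ∷ r))) (at e 0))
    ... | inj₁ a≡0 = ⊥-elim (a≢0 a≡0)
    ... | inj₂ q   = q

  integral : ∀ p r → p * r ≈ 0ₚ → p ≈ 0ₚ ⊎ r ≈ 0ₚ
  integral []      r e = inj₁ ≈-refl
  integral (a ∷ p) r e with a ℤₚ.≟ 0ℤ
  ... | no a≢0 = inj₂ (integral-head a p a≢0 r e)
  ... | yes a≡0 with integral p r (cancel-∷ (begin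
        0ℤ ∷ p * r    ≈⟨ ≈-sym (0∷-* p r) ⟩
        (0ℤ ∷ p) * r  ≈⟨ *-cong (∷-cong (sym a≡0) (≈-refl {p})) (≈-refl {r}) ⟩
        (a ∷ p) * r   ≈⟨ e ⟩
        []            ∎))
  ...   | inj₁ p≈0 = inj₁ (≈0-∷ a≡0 p≈0)
  ...   | inj₂ r≈0 = inj₂ r≈0

Nontrivial : CommutativeRing c ℓ → Set ℓ
Nontrivial R = ¬ (1# ≈ 0#)
  where open CommutativeRing R

NoZeroDivisors : CommutativeRing c ℓ → Set (c ⊔ ℓ)
NoZeroDivisors R = ∀ x y → x * y ≈ 0# → x ≈ 0# ⊎ y ≈ 0#
  where open CommutativeRing R

module Fractions (R : CommutativeRing c ℓ)
  (1≉0 : Nontrivial R) (integral : NoZeroDivisors R) where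

  open CommutativeRing R
  private
    module R = CommutativeRing R
  open RingProperties ring using (-‿distribˡ-*; -‿distribʳ-*; x∙y⁻¹≈ε⇒x≈y)
  open SetoidReasoning setoid
  open NatCoeffSolver commutativeSemiring using (solve; _:+_; _:*_; _:=_; con)

  record Fraction : Set (c ⊔ ℓ) where
    constructor frac
    field
      num   : Carrier
      den   : Carrier
      den≉0 : ¬ (den ≈ 0#)
  open Fraction public

  infix 4 _≃_
  record _≃_ (u v : Fraction) : Set ℓ where
    constructor mk≃
    field
      cross : num u * den v ≈ num v * den u
  open _≃_ public

  *-≉0 : ∀ {x y} → ¬ (x ≈ 0#) → ¬ (y ≈ 0#) → ¬ (x * y ≈ 0#)
  *-≉0 {x} {y} x≉0 y≉0 e with integral x y e
  ... | inj₁ x≈0 = x≉0 x≈0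
  ... | inj₂ y≈0 = y≉0 y≈0

  *-cancelˡ : ∀ z {x y} → ¬ (z ≈ 0#) → z * x ≈ z * y → x ≈ y
  *-cancelˡ z {x} {y} z≉0 e with integral z (x - y) (begin
      z * (x - y)          ≈⟨ distribˡ z x (- y) ⟩
      z * x + z * - y      ≈⟨ +-cong e (R.sym (-‿distribʳ-* z y)) ⟩
      z * y + - (z * y)    ≈⟨ -‿inverseʳ (z * y) ⟩
      0#                   ∎)
  ... | inj₁ z≈0   = ⊥-elim (z≉0 z≈0)
  ... | inj₂ x-y≈0 = x∙y⁻¹≈ε⇒x≈y x y x-y≈0

  infixl 6 _⊕_
  infixl 7 _⊗_
  _⊕_ _⊗_ : Fraction → Fraction → Fraction
  frac a b nb ⊕ frac a′ b′ nb′ = frac (a * b′ + a′ * b) (b * b′) (*-≉0 nb nb′)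
  frac a b nb ⊗ frac a′ b′ nb′ = frac (a * a′) (b * b′) (*-≉0 nb nb′)

  ⊖_ : Fraction → Fraction
  ⊖ frac a b nb = frac (- a) b nb

  ι : Carrier → Fraction
  ι a = frac a 1# 1≉0

  ≃-refl : ∀ {u} → u ≃ u
  ≃-refl = mk≃ R.refl

  ≃-sym : ∀ {u v} → u ≃ v → v ≃ u
  ≃-sym e = mk≃ (R.sym (cross e))

  ≃-trans : ∀ {u v w} → u ≃ v → v ≃ w → u ≃ w
  ≃-trans {frac a b _} {frac a′ b′ nb′} {frac a″ b″ _} (mk≃ e) (mk≃ f) =
    mk≃ (*-cancelˡ b′ nb′ (begin
      b′ * (a * b″)   ≈⟨ solve 3 (λ x y z → x :* (y :* z) := (y :* x) :* z) R.refl b′ a b″ ⟩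
      (a * b′) * b″   ≈⟨ *-congʳ e ⟩
      (a′ * b) * b″   ≈⟨ solve 3 (λ x y z → (x :* y) :* z := (x :* z) :* y) R.refl a′ b b″ ⟩
      (a′ * b″) * b   ≈⟨ *-congʳ f ⟩
      (a″ * b′) * b   ≈⟨ solve 3 (λ x y z → (x :* y) :* z := y :* (x :* z)) R.refl a″ b′ b ⟩
      b′ * (a″ * b)   ∎))

  ⊕-cong : ∀ {u u′ v v′} → u ≃ u′ → v ≃ v′ → u ⊕ v ≃ u′ ⊕ v′
  ⊕-cong {frac a b _} {frac a′ b′ _} {frac x y _} {frac x′ y′ _} (mk≃ e) (mk≃ f) = mk≃ (begin
    (a * y + x * b) * (b′ * y′)
      ≈⟨ solve 6 (λ a b x y b′ y′ → (a :* y :+ x :* b) :* (b′ :* y′)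
                   := (a :* b′) :* (y :* y′) :+ (x :* y′) :* (b :* b′)) R.refl a b x y b′ y′ ⟩
    (a * b′) * (y * y′) + (x * y′) * (b * b′)
      ≈⟨ +-cong (*-congʳ e) (*-congʳ f) ⟩
    (a′ * b) * (y * y′) + (x′ * y) * (b * b′)
      ≈⟨ solve 6 (λ a′ b x′ y b′ y′ → (a′ :* b) :* (y :* y′) :+ (x′ :* y) :* (b :* b′)
                   := (a′ :* y′ :+ x′ :* b′) :* (b :* y)) R.refl a′ b x′ y b′ y′ ⟩
    (a′ * y′ + x′ * b′) * (b * y) ∎)

  ⊗-cong : ∀ {u u′ v v′} → u ≃ u′ → v ≃ v′ → u ⊗ v ≃ u′ ⊗ v′
  ⊗-cong {frac a b _} {frac a′ b′ _} {frac x y _} {frac x′ y′ _} (mk≃ e) (mk≃ f) = mk≃ (begin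
    (a * x) * (b′ * y′)   ≈⟨ swap a x b′ y′ ⟩
    (a * b′) * (x * y′)   ≈⟨ *-cong e f ⟩
    (a′ * b) * (x′ * y)   ≈⟨ swap a′ b x′ y ⟩
    (a′ * x′) * (b * y)   ∎)
    where
    swap : ∀ p r s t → (p * r) * (s * t) ≈ (p * s) * (r * t)
    swap = solve 4 (λ p r s t → (p :* r) :* (s :* t) := (p :* s) :* (r :* t)) R.refl

  ⊖-cong : ∀ {u v} → u ≃ v → ⊖ u ≃ ⊖ v
  ⊖-cong {frac a b _} {frac a′ b′ _} (mk≃ e) = mk≃ (begin
    - a * b′     ≈⟨ R.sym (-‿distribˡ-* a b′) ⟩
    - (a * b′)   ≈⟨ -‿cong e ⟩
    - (a′ * b)   ≈⟨ -‿distribˡ-* a′ b ⟩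
    - a′ * b     ∎)

  ⊕-comm : ∀ u v → u ⊕ v ≃ v ⊕ u
  ⊕-comm (frac a b _) (frac x y _) = mk≃ (solve 4
    (λ a b x y → (a :* y :+ x :* b) :* (y :* b) := (x :* b :+ a :* y) :* (b :* y))
    R.refl a b x y)

  ⊕-assoc : ∀ u v w → (u ⊕ v) ⊕ w ≃ u ⊕ (v ⊕ w)
  ⊕-assoc (frac a b _) (frac x y _) (frac s t _) = mk≃ (solve 6
    (λ a b x y s t →
      ((a :* y :+ x :* b) :* t :+ s :* (b :* y)) :* (b :* (y :* t))
      := (a :* (y :* t) :+ (x :* t :+ s :* y) :* b) :* ((b :* y) :* t))
    R.refl a b x y s t)

  ⊕-identityˡ : ∀ u → ι 0# ⊕ u ≃ u
  ⊕-identityˡ (frac a b _) = mk≃ (solve 2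
    (λ a b → (con 0 :* b :+ a :* con 1) :* b := a :* (con 1 :* b)) R.refl a b)

  ⊖-inverseˡ : ∀ u → (⊖ u) ⊕ u ≃ ι 0#
  ⊖-inverseˡ (frac a b _) = mk≃ (begin
    (- a * b + a * b) * 1#       ≈⟨ *-congʳ (+-congʳ (R.sym (-‿distribˡ-* a b))) ⟩
    (- (a * b) + a * b) * 1#     ≈⟨ *-congʳ (-‿inverseˡ (a * b)) ⟩
    0# * 1#                      ≈⟨ zeroˡ 1# ⟩
    0#                           ≈⟨ R.sym (zeroˡ (b * b)) ⟩
    0# * (b * b)                 ∎)

  ⊗-comm : ∀ u v → u ⊗ v ≃ v ⊗ u
  ⊗-comm (frac a b _) (frac x y _) = mk≃ (solve 4
    (λ a b x y → (a :* x) :* (y :* b) := (x :* a) :* (b :* y)) R.refl a b x y)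

  ⊗-assoc : ∀ u v w → (u ⊗ v) ⊗ w ≃ u ⊗ (v ⊗ w)
  ⊗-assoc (frac a b _) (frac x y _) (frac s t _) = mk≃ (solve 6
    (λ a b x y s t →
      ((a :* x) :* s) :* (b :* (y :* t)) := (a :* (x :* s)) :* ((b :* y) :* t))
    R.refl a b x y s t)

  ⊗-identityˡ : ∀ u → ι 1# ⊗ u ≃ u
  ⊗-identityˡ (frac a b _) = mk≃ (solve 2
    (λ a b → (con 1 :* a) :* b := a :* (con 1 :* b)) R.refl a b)

  ⊗-distribˡ-⊕ : ∀ u v w → u ⊗ (v ⊕ w) ≃ (u ⊗ v) ⊕ (u ⊗ w)
  ⊗-distribˡ-⊕ (frac a b _) (frac x y _) (frac s t _) = mk≃ (solve 6
    (λ a b x y s t →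
      (a :* (x :* t :+ s :* y)) :* ((b :* y) :* (b :* t))
      := ((a :* x) :* (b :* t) :+ (a :* s) :* (b :* y)) :* (b :* (y :* t)))
    R.refl a b x y s t)

  fractionField : CommutativeRing (c ⊔ ℓ) ℓ
  fractionField = record
    { Carrier = Fraction ; _≈_ = _≃_ ; _+_ = _⊕_ ; _*_ = _⊗_ ; -_ = ⊖_
    ; 0# = ι 0# ; 1# = ι 1#
    ; isCommutativeRing = record
      { isRing = record
        { +-isAbelianGroup = record
          { isGroup = record
            { isMonoid = record
              { isSemigroup = record
                { isMagma = record
                  { isEquivalence = record { refl = ≃-refl ; sym = ≃-sym ; trans = ≃-trans }
                  ; ∙-cong = ⊕-cong }
                ; assoc = ⊕-assoc }
              ; identity = ⊕-identityˡ
                         , λ u → ≃-trans (⊕-comm u (ι 0#)) (⊕-identityˡ u) }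
            ; inverse = ⊖-inverseˡ
                      , λ u → ≃-trans (⊕-comm u (⊖ u)) (⊖-inverseˡ u)
            ; ⁻¹-cong = ⊖-cong }
          ; comm = ⊕-comm }
        ; *-cong = ⊗-cong
        ; *-assoc = ⊗-assoc
        ; *-identity = ⊗-identityˡ
                     , λ u → ≃-trans (⊗-comm u (ι 1#)) (⊗-identityˡ u)
        ; distrib = ⊗-distribˡ-⊕
                  , λ u v w → ≃-trans (⊗-comm (v ⊕ w) u) (≃-trans (⊗-distribˡ-⊕ u v w)
                      (⊕-cong (⊗-comm u v) (⊗-comm u w))) }
      ; *-comm = ⊗-comm }
    }

ℤ[q] : CommutativeRing 0ℓ 0ℓ
ℤ[q] = Polynomials.commutativeRing

module Frac = Fractions ℤ[q] Polynomials.1≉0 Polynomials.integral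

-- ℚ(q), as the field of fractions of ℤ[q].
ℚ⟨q⟩ : CommutativeRing 0ℓ 0ℓ
ℚ⟨q⟩ = Frac.fractionField

module P = RingDefs ℤ[q]
module Q = RingDefs ℚ⟨q⟩

q : Polynomials.Poly
q = 0ℤ ∷ 1ℤ ∷ []

qfac : ℕ → Polynomials.Poly
qfac n = P.poch q q n

coeff₀-qfac : ∀ n → Polynomials.coeff (qfac n) 0 ≡ 1ℤ
coeff₀-qfac n = go n (λ j → 1# - q * q P.^ toℕ j) (λ j → factor (q P.^ toℕ j))
  where
  open CommutativeRing ℤ[q] using (Carrier; 1#; _-_; _*_; -_)
  open Polynomials using (coeff; coeff-+; coeff-neg; coeff₀-*)
  factor : ∀ p → coeff (1# - q * p) 0 ≡ 1ℤ
  factor p = trans (coeff-+ 1# (- (q * p)) 0)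
    (cong (λ z → 1ℤ ℤ.+ z) (trans (coeff-neg (q * p) 0) (cong (λ a → ℤ.- a) (coeff₀-* q p))))
  go : ∀ n (f : Vector Carrier n) → (∀ j → coeff (f j) 0 ≡ 1ℤ) → coeff (P.product f) 0 ≡ 1ℤ
  go zero    f h = refl
  go (suc n) f h = trans (coeff₀-* (f Fin.zero) _)
    (cong₂ ℤ._*_ (h Fin.zero) (go n (λ j → f (Fin.suc j)) (λ j → h (Fin.suc j))))

qfac≉0 : ∀ n → ¬ (qfac n Polynomials.≈ Polynomials.0ₚ)
qfac≉0 n e with trans (sym (coeff₀-qfac n)) (Polynomials.at e 0)
... | ()

infix 8 _/qfac_
_/qfac_ : Polynomials.Poly → ℕ → Frac.Fraction
p /qfac n = Frac.frac p (qfac n) (qfac≉0 n)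

-- The 1-based position of an index; Fin counts from 0.
pos : ∀ {m} → Fin m → ℕ
pos i = suc (toℕ i)

record Admissible {m : ℕ} (a : Vector ℤ m) : Set where
  field
    increasing : ∀ i j → i Fin.< j → a i ℤ.< a j
    lower      : ∀ i → + (2 ℕ.* pos i) ℤ.- 1ℤ ℤ.≤ a i
    upper      : ∀ i → a i ℤ.≤ + (2 ℕ.* m)

-- aⱼ + 1 - 2i
shift : ∀ {m} → Vector ℤ m → Fin m → Fin m → ℤ
shift a i j = a j ℤ.+ 1ℤ ℤ.- + (2 ℕ.* pos i)

mEntry : (i x : ℕ) → ℤ → Frac.Fraction
mEntry i x (+ n)    = P.poch (q P.^ (2 ℕ.* i ℕ.+ 2 ℕ.* x)) (q P.^ 2) n /qfac n
mEntry i x -[1+ _ ] = CommutativeRing.0# ℚ⟨q⟩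

sEntry : ℤ → Frac.Fraction
sEntry (+ n)    = Polynomials.1ₚ /qfac n
sEntry -[1+ _ ] = CommutativeRing.0# ℚ⟨q⟩

mMatrix : ∀ {m} → Vector ℤ m → ℕ → Q.Matrix m
mMatrix a x i j = mEntry (pos i) x (shift a i j)

sMatrix : ∀ {m} → Vector ℤ m → Q.Matrix m
sMatrix a i j = sEntry (shift a i j)

-- (q^{2x+2k}; q) of length aₖ - 2k + 1. That length is nonnegative for
-- admissible a, so the absolute value does not alter it.
rowFactor : ∀ {m} → Vector ℤ m → ℕ → Fin m → Frac.Fraction
rowFactor a x k = Frac.ι
  (P.poch (q P.^ (2 ℕ.* x ℕ.+ 2 ℕ.* pos k)) q ℤ.∣ a k ℤ.- + (2 ℕ.* pos k) ℤ.+ 1ℤ ∣)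

{-# OPTIONS --safe #-}
-- Put w = q^{2x+1} and, for zero-based rows k, let N be the matrix with entries
-- (w q^{2k+1}; q)_n / (q; q)_n, n = a_j - 1 - 2k. The q-Gauss sum in base q² reads
--   (wq; q²)_n / (q; q)_n = Σ_r ℓ_r(w) (w q^{2r+1}; q)_{n-2r} / (q; q)_{n-2r}
-- with ℓ_0 = 1 and ℓ_r independent of n, and it only involves 2r ≤ n. Since
-- a_j ≤ 2m, no row beyond the m-th is needed, so m(a, x) = L N with L upper
-- unitriangular, and det m(a, x) = det N. Finally N is s(a) with column j
-- multiplied by (wq; q)_{a_j - 1} and row k divided by (wq; q)_{2k}.
module Submission where

open import Defs
open import Algebra.Bundles using (CommutativeRing)
open import Data.Integer.Base using (ℤ)
open import Data.Nat.Base using (ℕ; _≥_)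
open import Data.Vec.Functional using (Vector)
import Algebra.Properties.AbelianGroup as AbelianGroupProperties
import Algebra.Properties.CommutativeMonoid.Sum as CommutativeMonoidSum
import Algebra.Properties.CommutativeSemiring.Exp as CommutativeSemiringExp
import Algebra.Properties.Ring as RingProperties
import Algebra.Properties.Semiring.Mult.TCOptimised as SemiringMult
import Algebra.Properties.Semiring.Sum as SemiringSum
import Algebra.Solver.Ring as RingSolver
open import Algebra.Solver.Ring.AlmostCommutativeRing
  using (fromCommutativeRing; _-Raw-AlmostCommutative⟶_)
open import Data.Fin.Base as Fin using (Fin; zero; suc; toℕ; punchIn; lift)
open import Data.Integer.Base as ℤ using (+_; -[1+_])
import Data.Integer.Properties as ℤₚ
open import Data.Maybe.Base using (just; nothing)
open import Data.Nat.Base as ℕ using (zero; suc; z≤n; s≤s)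
import Data.Nat.Properties as ℕₚ
open import Data.Product.Base using (∃; _,_; proj₁; proj₂; _×_)
open import Data.Vec.Functional using (_∷_; head; tail)
open import Function.Base using (_∘_)
open import Level using (Level)
open import Relation.Binary.Definitions using (WeaklyDecidable)
open import Relation.Binary.PropositionalEquality as ≡ using (_≡_; _≗_)
import Relation.Binary.Reasoning.Setoid as SetoidReasoning
open import Relation.Nullary using (yes; no)

-- The decomposition works because ℓ_r is free of n: one matrix L then serves every column.
-- Multiplied by (q; q)_n / (wq; q)_n, the sum is the terminating series 2φ1(q^(-n), q^(1-n); wq²;
-- q², wq^(2n+1)). Here (q^(-n); q²)_r (q^(1-n); q²)_r = (q^(-n); q)_{2r} yields 1/(q; q)_{n-2r} up
-- to a power of q, whose dependence on n is cancelled by the argument of the series. Row k uses the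
-- sum with w q^(2k) in place of w. The sum is evaluated by a first-order recurrence in n satisfied
-- by both sides, and the only denominators are factors 1 - q^n. The argument therefore takes place
-- in a commutative ring with an element q and given inverses e_n of (q; q)_n; fractions of
-- polynomials enter once the identity is established there. The parameter is carried as wq because
-- the certificate contains (w q^(2r); q)_d and q need not be invertible in that ring. Dividing row
-- k by (wq; q)_{2k} is legitimate because w is a power of q, so that (wq; q)_{2k} divides some (q;
-- q)_n.

private
  variable
    c ℓ : Level

-- Ring solver with integer coefficients over any commutative ring.

module IntegerCoefficients (R : CommutativeRing c ℓ) where

  open CommutativeRing R hiding (zero)
  open SemiringMult semiring using (×-homo-+; ×1-homo-*) renaming (_×_ to _·_)
  open RingProperties ring
    using (-‿involutive; -‿distribˡ-*; -‿distribʳ-*; -0#≈0#)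
  open AbelianGroupProperties +-abelianGroup using (⁻¹-∙-comm)
  open SetoidReasoning setoid

  private
    -- With the optimised multiples, 1 · 1# computes to 1#, so `con (+ 1)` stands for the literal
    -- `1#` of the goals. Cancellations such as 1 - 1 are decided in ℤ, as R has no decidable
    -- equality.
    ⟦_⟧ : ℤ → Carrier
    ⟦ + n ⟧      = n · 1#
    ⟦ -[1+ n ] ⟧ = - (suc n · 1#)

    neg-homo : ∀ i → ⟦ ℤ.- i ⟧ ≈ - ⟦ i ⟧
    neg-homo (+ zero)  = sym -0#≈0#
    neg-homo (+ suc n) = refl
    neg-homo -[1+ n ]  = sym (-‿involutive _)

    cancel : ∀ x y z → (x + y) - (x + z) ≈ y - z
    cancel x y z = begin
      (x + y) - (x + z)      ≈⟨ +-cong (+-comm x y) (sym (⁻¹-∙-comm x z)) ⟩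
      (y + x) + (- x - z)    ≈⟨ +-assoc y x _ ⟩
      y + (x + (- x - z))    ≈⟨ +-congˡ (sym (+-assoc x (- x) _)) ⟩
      y + ((x - x) - z)      ≈⟨ +-congˡ (+-congʳ (-‿inverseʳ x)) ⟩
      y + (0# - z)           ≈⟨ +-congˡ (+-identityˡ _) ⟩
      y - z                  ∎

    ⊖-homo : ∀ m n → ⟦ m ℤ.⊖ n ⟧ ≈ m · 1# - n · 1#
    ⊖-homo m       zero    = sym (trans (+-congˡ -0#≈0#) (+-identityʳ _))
    ⊖-homo zero    (suc n) = sym (+-identityˡ _)
    ⊖-homo (suc m) (suc n) = begin
      ⟦ suc m ℤ.⊖ suc n ⟧              ≡⟨ ≡.cong ⟦_⟧ (ℤₚ.[1+m]⊖[1+n]≡m⊖n m n) ⟩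
      ⟦ m ℤ.⊖ n ⟧                      ≈⟨ ⊖-homo m n ⟩
      m · 1# - n · 1#                  ≈⟨ cancel 1# _ _ ⟨
      (1# + m · 1#) - (1# + n · 1#)    ≈⟨ +-cong (×-homo-+ 1# 1 m) (-‿cong (×-homo-+ 1# 1 n)) ⟨
      suc m · 1# - suc n · 1#          ∎

    +-homo : ∀ i j → ⟦ i ℤ.+ j ⟧ ≈ ⟦ i ⟧ + ⟦ j ⟧
    +-homo (+ m)    (+ n)    = ×-homo-+ 1# m n
    +-homo (+ m)    -[1+ n ] = ⊖-homo m (suc n)
    +-homo -[1+ m ] (+ n)    = trans (⊖-homo n (suc m)) (+-comm _ _)
    +-homo -[1+ m ] -[1+ n ] = begin
      - (suc (suc (m ℕ.+ n)) · 1#)       ≡⟨ ≡.cong (λ k → - (suc k · 1#)) (ℕₚ.+-suc m n) ⟨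
      - ((suc m ℕ.+ suc n) · 1#)         ≈⟨ -‿cong (×-homo-+ 1# (suc m) (suc n)) ⟩
      - (suc m · 1# + suc n · 1#)        ≈⟨ ⁻¹-∙-comm _ _ ⟨
      - (suc m · 1#) - suc n · 1#        ∎

    *-homo⁺ : ∀ m n → ⟦ + m ℤ.* + n ⟧ ≈ ⟦ + m ⟧ * ⟦ + n ⟧
    *-homo⁺ m n = trans (reflexive (≡.cong ⟦_⟧ (≡.sym (ℤₚ.pos-* m n)))) (×1-homo-* m n)

    *-homoʳ : ∀ m j → ⟦ + m ℤ.* j ⟧ ≈ ⟦ + m ⟧ * ⟦ j ⟧
    *-homoʳ m (+ n)    = *-homo⁺ m n
    *-homoʳ m -[1+ n ] = begin
      ⟦ + m ℤ.* -[1+ n ] ⟧          ≡⟨ ≡.cong ⟦_⟧ (ℤₚ.neg-distribʳ-* (+ m) (+ suc n)) ⟨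
      ⟦ ℤ.- (+ m ℤ.* + suc n) ⟧     ≈⟨ neg-homo (+ m ℤ.* + suc n) ⟩
      - ⟦ + m ℤ.* + suc n ⟧         ≈⟨ -‿cong (*-homo⁺ m (suc n)) ⟩
      - (⟦ + m ⟧ * ⟦ + suc n ⟧)     ≈⟨ -‿distribʳ-* _ _ ⟩
      ⟦ + m ⟧ * ⟦ -[1+ n ] ⟧        ∎

    *-homo : ∀ i j → ⟦ i ℤ.* j ⟧ ≈ ⟦ i ⟧ * ⟦ j ⟧
    *-homo (+ m)    j = *-homoʳ m j
    *-homo -[1+ m ] j = begin
      ⟦ -[1+ m ] ℤ.* j ⟧            ≡⟨ ≡.cong ⟦_⟧ (ℤₚ.neg-distribˡ-* (+ suc m) j) ⟨
      ⟦ ℤ.- (+ suc m ℤ.* j) ⟧       ≈⟨ neg-homo (+ suc m ℤ.* j) ⟩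
      - ⟦ + suc m ℤ.* j ⟧           ≈⟨ -‿cong (*-homoʳ (suc m) j) ⟩
      - (⟦ + suc m ⟧ * ⟦ j ⟧)       ≈⟨ -‿distribˡ-* _ _ ⟩
      ⟦ -[1+ m ] ⟧ * ⟦ j ⟧          ∎

    morphism : ℤ.+-*-rawRing -Raw-AlmostCommutative⟶ fromCommutativeRing R
    morphism = record
      { ⟦_⟧ = ⟦_⟧ ; +-homo = +-homo ; *-homo = *-homo ; -‿homo = neg-homo
      ; 0-homo = refl ; 1-homo = refl }

    dec : WeaklyDecidable (λ i j → ⟦ i ⟧ ≈ ⟦ j ⟧)
    dec i j with i ℤₚ.≟ j
    ... | yes i≡j = just (reflexive (≡.cong ⟦_⟧ i≡j))
    ... | no  _   = nothing

  open RingSolver ℤ.+-*-rawRing (fromCommutativeRing R) morphism dec public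
    using (solve; _:+_; _:*_; _:-_; :-_; _:=_; con)

-- Determinants: alternation, unitriangular factors, scaling.

module Determinants (R : CommutativeRing c ℓ) where

  open CommutativeRing R hiding (zero)
  open RingDefs R
  open IntegerCoefficients R
  open SemiringSum semiring
    using (sum-cong-≋; sum-replicate-zero; ∑-distrib-+; ∑-comm; *-distribˡ-sum)
  open CommutativeMonoidSum *-commutativeMonoid
    using () renaming (sum-remove to product-remove)
  open SetoidReasoning setoid

  private
    variable
      n : ℕ

  sign : Fin n → Carrier
  sign j = (- 1#) ^ toℕ j

  minor : Vector (Vector Carrier (suc n)) n → Fin (suc n) → Matrix n
  minor rows j i k = rows i (punchIn j k)

  sum-zero : {f : Vector Carrier n} → (∀ i → f i ≈ 0#) → sum f ≈ 0#
  sum-zero {n} h = trans (sum-cong-≋ h) (sum-replicate-zero n)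

  det-cong : {A B : Matrix n} → (∀ i j → A i j ≈ B i j) → det A ≈ det B
  det-cong {zero}  h = refl
  det-cong {suc n} h = sum-cong-≋ λ j → *-congˡ {x = sign j}
    (*-cong (h zero j) (det-cong λ i k → h (suc i) (punchIn j k)))

  -- Column selections are functions, and the same selection arises from different composites of
  -- `punchIn` and `lift`. Without function extensionality, a minor must be known to respect
  -- pointwise equality.
  Extensional : {m : ℕ} → ((Fin n → Fin m) → Carrier) → Set ℓ
  Extensional G = ∀ {σ τ} → σ ≗ τ → G σ ≈ G τ

  -- The expansion of a determinant along its first two rows u and v, where
  -- G σ stands for the minor of the remaining rows on the columns σ.
  expand₂ : (u v : Vector Carrier (2 ℕ.+ n)) → ((Fin n → Fin (2 ℕ.+ n)) → Carrier) → Carrier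
  expand₂ u v G = sum λ j → sign j * (u j * sum λ k →
    sign k * (v (punchIn j k) * G (punchIn j ∘ punchIn k)))

  module _ (u v : Vector Carrier (2 ℕ.+ n)) (G : (Fin n → Fin (2 ℕ.+ n)) → Carrier) where

    -- The other of the two rows takes column 0; `t` supplies the entry from column k + 1.
    withColumn₀ : Vector Carrier (2 ℕ.+ n) → Carrier
    withColumn₀ t = sum λ k → sign k * (t (suc k) * G (suc ∘ punchIn k))

    withoutColumn₀ : Carrier
    withoutColumn₀ = sum λ j → sign j * (u (suc j) * sum λ k →
      sign k * (v (suc (punchIn j k)) * G (punchIn (suc j) ∘ punchIn (suc k))))

    -- Pairs of columns are sorted by whether `u`, `v` or neither takes column 0. If `v` does, then
    -- j > 0 and k = 0, whence the minus sign; if neither does, both indices drop by one and the two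
    -- sign changes cancel.
    expand₂-split : expand₂ u v G ≈
      (head u * withColumn₀ v - head v * withColumn₀ u) + withoutColumn₀
    expand₂-split = begin
      1# * (head u * withColumn₀ v) + sum (λ j → term j)
        ≈⟨ +-cong (*-identityˡ _) (sum-cong-≋ term-split) ⟩
      head u * withColumn₀ v + sum (λ j → - head v * with₀ j + without₀ j)
        ≈⟨ +-congˡ (∑-distrib-+ (λ j → - head v * with₀ j) without₀) ⟩
      head u * withColumn₀ v + (sum (λ j → - head v * with₀ j) + withoutColumn₀)
        ≈⟨ +-congˡ (+-congʳ (sym (*-distribˡ-sum (- head v) with₀))) ⟩
      head u * withColumn₀ v + (- head v * withColumn₀ u + withoutColumn₀)
        ≈⟨ solve 5 (λ a b c d e → a :* b :+ (:- c :* d :+ e) := (a :* b :- c :* d) :+ e)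
             refl (head u) (withColumn₀ v) (head v) (withColumn₀ u) withoutColumn₀ ⟩
      (head u * withColumn₀ v - head v * withColumn₀ u) + withoutColumn₀ ∎
      where
      inner : Fin (suc n) → Fin n → Carrier
      inner j k = v (suc (punchIn j k)) * G (punchIn (suc j) ∘ punchIn (suc k))
      with₀ without₀ term : Fin (suc n) → Carrier
      with₀ j    = sign j * (u (suc j) * G (suc ∘ punchIn j))
      without₀ j = sign j * (u (suc j) * sum λ k → sign k * inner j k)
      term j     = sign (suc j) * (u (suc j) *
        (1# * (head v * G (suc ∘ punchIn j)) + sum λ k → sign (suc k) * inner j k))
      term-split : ∀ j → term j ≈ - head v * with₀ j + without₀ j
      term-split j = begin
        term j
          ≈⟨ *-congˡ (*-congˡ (+-congˡ (trans
               (sum-cong-≋ λ k → *-assoc (- 1#) (sign k) (inner j k))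
               (sym (*-distribˡ-sum (- 1#) (λ k → sign k * inner j k)))))) ⟩
        sign (suc j) * (u (suc j) * (1# * (head v * G (suc ∘ punchIn j)) + - 1# * s))
          ≈⟨ solve 5 (λ e a b g s → (:- con (+ 1) :* e) :* (a :* (con (+ 1) :* (b :* g) :+ :- con (+ 1) :* s))
               := :- b :* (e :* (a :* g)) :+ e :* (a :* s))
               refl (sign j) (u (suc j)) (head v) (G (suc ∘ punchIn j)) s ⟩
        - head v * with₀ j + without₀ j ∎
        where
        s : Carrier
        s = sum λ k → sign k * inner j k

  -- Every selection that remains has the form lift 1 σ, as it contains column 0.
  withoutColumn₀-expand₂ : (u v : Vector Carrier (3 ℕ.+ n))
    (G : (Fin (suc n) → Fin (3 ℕ.+ n)) → Carrier) → Extensional G →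
    withoutColumn₀ u v G ≈ expand₂ (tail u) (tail v) (G ∘ lift 1)
  withoutColumn₀-expand₂ {n} u v G ext = sum-cong-≋ {x = λ j → outer j (inner j)} λ j →
    *-congˡ {x = sign j} (*-congˡ (sum-cong-≋ {x = inner j} λ k →
      *-congˡ {x = sign k} (*-congˡ (keeps j k))))
    where
    outer : Fin (2 ℕ.+ n) → Vector Carrier (suc n) → Carrier
    outer j f = sign j * (u (suc j) * sum f)
    inner : Fin (2 ℕ.+ n) → Fin (suc n) → Carrier
    inner j k = sign k * (v (suc (punchIn j k)) * G (punchIn (suc j) ∘ punchIn (suc k)))
    keeps : ∀ j k → G (punchIn (suc j) ∘ punchIn (suc k)) ≈ G (lift 1 (punchIn j ∘ punchIn k))
    keeps j k = ext λ { zero → ≡.refl ; (suc l) → ≡.refl }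

  -- The part with column 0 cancels when both rows agree, and the part without it is the same
  -- problem on one column fewer. Antisymmetry alone would not give this: R may have 2-torsion, so x
  -- + x = 0 does not yield x = 0.
  expand₂-alternating : ∀ {n} (u : Vector Carrier (2 ℕ.+ n))
    (G : (Fin n → Fin (2 ℕ.+ n)) → Carrier) → Extensional G →
    expand₂ u u G ≈ 0#
  expand₂-alternating {n} u G ext = begin
    expand₂ u u G
      ≈⟨ expand₂-split u u G ⟩
    (head u * withColumn₀ u u G u - head u * withColumn₀ u u G u) + withoutColumn₀ u u G
      ≈⟨ +-cong (-‿inverseʳ _) (rest n u G ext) ⟩
    0# + 0#
      ≈⟨ +-identityˡ 0# ⟩
    0# ∎
    where
    rest : ∀ n (u : Vector Carrier (2 ℕ.+ n)) (G : (Fin n → Fin (2 ℕ.+ n)) → Carrier) →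
      Extensional G → withoutColumn₀ u u G ≈ 0#
    -- Without column 0 only one of two columns is left, so the inner sum is empty.
    rest zero    u G ext = sum-zero λ j → trans (*-congˡ {x = sign j} (zeroʳ (u (suc j)))) (zeroʳ _)
    rest (suc n) u G ext = trans (withoutColumn₀-expand₂ u u G ext)
      (expand₂-alternating (tail u) (G ∘ lift 1) λ e → ext λ
        { zero → ≡.refl ; (suc l) → ≡.cong suc (e l) })

  expand₂-antisym : ∀ {n} (u v : Vector Carrier (2 ℕ.+ n))
    (G : (Fin n → Fin (2 ℕ.+ n)) → Carrier) → Extensional G →
    expand₂ u v G + expand₂ v u G ≈ 0#
  expand₂-antisym {n} u v G ext = begin
    expand₂ u v G + expand₂ v u G
      ≈⟨ +-cong (expand₂-split u v G) (expand₂-split v u G) ⟩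
    ((head u * withColumn₀ u v G v - head v * withColumn₀ u v G u) + withoutColumn₀ u v G)
      + ((head v * withColumn₀ u v G u - head u * withColumn₀ u v G v) + withoutColumn₀ v u G)
      ≈⟨ solve 4 (λ a b c d → ((a :- b) :+ c) :+ ((b :- a) :+ d) := c :+ d) refl
           (head u * withColumn₀ u v G v) (head v * withColumn₀ u v G u)
           (withoutColumn₀ u v G) (withoutColumn₀ v u G) ⟩
    withoutColumn₀ u v G + withoutColumn₀ v u G
      ≈⟨ rest n u v G ext ⟩
    0# ∎
    where
    rest : ∀ n (u v : Vector Carrier (2 ℕ.+ n)) (G : (Fin n → Fin (2 ℕ.+ n)) → Carrier) →
      Extensional G → withoutColumn₀ u v G + withoutColumn₀ v u G ≈ 0#
    rest zero    u v G ext = trans (+-cong (vanish u) (vanish v)) (+-identityˡ 0#)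
      where
      vanish : (t : Vector Carrier 2) → (sum λ (j : Fin 1) → sign j * (t (suc j) * 0#)) ≈ 0#
      vanish t = sum-zero λ j → trans (*-congˡ {x = sign j} (zeroʳ (t (suc j)))) (zeroʳ _)
    rest (suc n) u v G ext = trans
      (+-cong (withoutColumn₀-expand₂ u v G ext) (withoutColumn₀-expand₂ v u G ext))
      (expand₂-antisym (tail u) (tail v) (G ∘ lift 1) λ e → ext λ
        { zero → ≡.refl ; (suc l) → ≡.cong suc (e l) })

  minor-ext : (rows : Vector (Vector Carrier (2 ℕ.+ n)) n) {σ τ : Fin n → Fin (2 ℕ.+ n)} →
    σ ≗ τ → det (λ i → rows i ∘ σ) ≈ det (λ i → rows i ∘ τ)
  minor-ext rows σ≗τ = det-cong λ i l → reflexive (≡.cong (rows i) (σ≗τ l))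

  -- If the copy lies further down, swapping the first two rows changes the sign. After the swap
  -- every minor along the first row has the repeated row on top, and induction applies.
  det-repeated-row : (rows : Vector (Vector Carrier (suc n)) n) (k : Fin n) →
    det (rows k ∷ rows) ≈ 0#
  det-repeated-row rows zero =
    expand₂-alternating (head rows) (λ σ → det λ i → tail rows i ∘ σ) (minor-ext (tail rows))
  det-repeated-row rows (suc k) = begin
    det (rows (suc k) ∷ rows)
      ≈⟨ +-identityʳ _ ⟨
    det (rows (suc k) ∷ rows) + 0#
      ≈⟨ +-congˡ swapped≈0 ⟨
    det (rows (suc k) ∷ rows) + det (head rows ∷ rows (suc k) ∷ tail rows)
      ≈⟨ expand₂-antisym (rows (suc k)) (head rows)
           (λ σ → det λ i → tail rows i ∘ σ) (minor-ext (tail rows)) ⟩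
    0# ∎
    where
    swapped≈0 : det (head rows ∷ rows (suc k) ∷ tail rows) ≈ 0#
    swapped≈0 = sum-zero λ j → trans
      (*-congˡ {x = sign j} (trans (*-congˡ {x = rows zero j} (minor≈0 j)) (zeroʳ _)))
      (zeroʳ _)
      where
      minor≈0 : ∀ j → det (minor (rows (suc k) ∷ tail rows) j) ≈ 0#
      minor≈0 j = trans
        (det-cong {A = minor (rows (suc k) ∷ tail rows) j}
                  {B = (tail rows k ∘ punchIn j) ∷ λ i → tail rows i ∘ punchIn j}
          λ { zero l → refl ; (suc i) l → refl })
        (det-repeated-row (λ i → tail rows i ∘ punchIn j) k)

  record UpperUnitriangular (L : Matrix n) : Set ℓ where
    field
      diagonal : ∀ i → L i i ≈ 1#
      below    : ∀ i k → k Fin.< i → L i k ≈ 0#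

  -- Below the first row L is again unitriangular, and deleting a column commutes with
  -- multiplication by L on the left, so by induction A and B have equal minors there. Linearity in
  -- the first row gives the sum over k of L_{0k} times the determinant with row k of B on top of
  -- the lower rows of B; for k > 0 a row is repeated.
  det-upperUnitriangular-* : {L A B : Matrix n} → UpperUnitriangular L →
    (∀ i j → A i j ≈ sum λ k → L i k * B k j) → det A ≈ det B
  det-upperUnitriangular-* {zero}                  uL h = refl
  det-upperUnitriangular-* {suc n} {L} {A} {B} uL h = begin
    (sum λ j → sign j * (A zero j * det (minor (tail A) j)))
      ≈⟨ sum-cong-≋ (λ j → *-congˡ {x = sign j} (*-cong (h zero j) (minors j))) ⟩
    (sum λ j → sign j * (sum (λ k → L zero k * B k j) * cofactor j))
      ≈⟨ sum-cong-≋ distribute ⟩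
    (sum λ j → sum λ k → L zero k * (sign j * (B k j * cofactor j)))
      ≈⟨ ∑-comm (λ j k → L zero k * (sign j * (B k j * cofactor j))) ⟩
    (sum λ k → sum λ j → L zero k * (sign j * (B k j * cofactor j)))
      ≈⟨ sum-cong-≋ (λ k → sym (*-distribˡ-sum (L zero k) (λ j → sign j * (B k j * cofactor j)))) ⟩
    (sum λ k → L zero k * det (B k ∷ tail B))
      ≈⟨ +-cong (trans (*-congʳ (diagonal zero)) (*-identityˡ _))
           (sum-zero λ k → trans (*-congˡ {x = L zero (suc k)} (det-repeated-row (tail B) k)) (zeroʳ _)) ⟩
    det B + 0#
      ≈⟨ +-identityʳ _ ⟩
    det B ∎
    where
    open UpperUnitriangular uL
    cofactor : Fin (suc n) → Carrier
    cofactor j = det (minor (tail B) j)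
    uL′ : UpperUnitriangular (λ i k → L (suc i) (suc k))
    uL′ = record
      { diagonal = λ i → diagonal (suc i)
      ; below    = λ i k k<i → below (suc i) (suc k) (s≤s k<i) }
    minors : ∀ j → det (minor (tail A) j) ≈ cofactor j
    minors j = det-upperUnitriangular-* uL′ λ i l → begin
      A (suc i) (punchIn j l)
        ≈⟨ h (suc i) (punchIn j l) ⟩
      L (suc i) zero * B zero (punchIn j l) + sum (λ k → L (suc i) (suc k) * B (suc k) (punchIn j l))
        ≈⟨ +-congʳ (trans (*-congʳ (below (suc i) zero (s≤s z≤n))) (zeroˡ _)) ⟩
      0# + sum (λ k → L (suc i) (suc k) * B (suc k) (punchIn j l))
        ≈⟨ +-identityˡ _ ⟩
      sum (λ k → L (suc i) (suc k) * B (suc k) (punchIn j l)) ∎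
    distribute : ∀ j → sign j * (sum (λ k → L zero k * B k j) * cofactor j) ≈
      sum (λ k → L zero k * (sign j * (B k j * cofactor j)))
    distribute j = begin
      sign j * (sum (λ k → L zero k * B k j) * cofactor j)
        ≈⟨ solve 3 (λ s t d → s :* (t :* d) := (s :* d) :* t) refl (sign j) _ (cofactor j) ⟩
      (sign j * cofactor j) * sum (λ k → L zero k * B k j)
        ≈⟨ *-distribˡ-sum (sign j * cofactor j) (λ k → L zero k * B k j) ⟩
      sum (λ k → (sign j * cofactor j) * (L zero k * B k j))
        ≈⟨ sum-cong-≋ (λ k → solve 4 (λ s d l b → (s :* d) :* (l :* b) := l :* (s :* (b :* d)))
             refl (sign j) (cofactor j) (L zero k) (B k j)) ⟩
      sum (λ k → L zero k * (sign j * (B k j * cofactor j))) ∎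

  det-scaleRows : (r : Vector Carrier n) (A : Matrix n) →
    det (λ i j → r i * A i j) ≈ product r * det A
  det-scaleRows {zero}  r A = sym (*-identityˡ _)
  det-scaleRows {suc n} r A = begin
    (sum λ j → sign j * ((r zero * A zero j) * det (minor (λ i k → r (suc i) * A (suc i) k) j)))
      ≈⟨ sum-cong-≋ (λ j → trans
           (*-congˡ {x = sign j} (*-congˡ (det-scaleRows (tail r) (minor (tail A) j))))
           (solve 5 (λ s r a p d → s :* ((r :* a) :* (p :* d)) := (r :* p) :* (s :* (a :* d)))
              refl (sign j) (r zero) (A zero j) (product (tail r)) (det (minor (tail A) j)))) ⟩
    (sum λ j → product r * (sign j * (A zero j * det (minor (tail A) j))))
      ≈⟨ *-distribˡ-sum (product r) (λ j → sign j * (A zero j * det (minor (tail A) j))) ⟨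
    product r * det A ∎

  det-scaleColumns : (r : Vector Carrier n) (A : Matrix n) →
    det (λ i j → r j * A i j) ≈ product r * det A
  det-scaleColumns {zero}  r A = sym (*-identityˡ _)
  det-scaleColumns {suc n} r A = begin
    (sum λ j → sign j * ((r j * A zero j) * det (minor (λ i k → r k * A (suc i) k) j)))
      ≈⟨ sum-cong-≋ (λ j → trans
           (*-congˡ {x = sign j} (*-congˡ (det-scaleColumns (r ∘ punchIn j) (minor (tail A) j))))
           (trans
             (solve 5 (λ s r a p d → s :* ((r :* a) :* (p :* d)) := (r :* p) :* (s :* (a :* d)))
               refl (sign j) (r j) (A zero j) (product (r ∘ punchIn j)) (det (minor (tail A) j)))
             -- Whichever column the first row takes, its factor and those of the minor make up the
             -- whole product.
             (*-congʳ (sym (product-remove r))))) ⟩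
    (sum λ j → product r * (sign j * (A zero j * det (minor (tail A) j))))
      ≈⟨ *-distribˡ-sum (product r) (λ j → sign j * (A zero j * det (minor (tail A) j))) ⟨
    product r * det A ∎

-- Splitting rules for q-Pochhammer symbols.

module Pochhammer (R : CommutativeRing c ℓ) where

  open CommutativeRing R hiding (zero)
  open RingDefs R
  open IntegerCoefficients R
  open CommutativeSemiringExp commutativeSemiring using (^-congˡ)
  open CommutativeMonoidSum *-commutativeMonoid
    using () renaming (sum-cong-≋ to product-cong-≋)
  open SetoidReasoning setoid

  1-cong : ∀ {x y} → x ≈ y → 1# - x ≈ 1# - y
  1-cong x≈y = +-congˡ (-‿cong x≈y)

  poch-cong : ∀ {a a′ b b′} → a ≈ a′ → b ≈ b′ → ∀ n → poch a b n ≈ poch a′ b′ n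
  poch-cong a≈a′ b≈b′ n = product-cong-≋ λ (j : Fin n) →
    1-cong (*-cong a≈a′ (^-congˡ (toℕ j) b≈b′))

  poch-congˡ : ∀ {a a′ b} → a ≈ a′ → ∀ n → poch a b n ≈ poch a′ b n
  poch-congˡ a≈a′ = poch-cong a≈a′ refl

  poch-suc : ∀ a b n → poch a b (suc n) ≈ (1# - a) * poch (a * b) b n
  poch-suc a b n = *-cong (1-cong (*-identityʳ a))
    (product-cong-≋ λ (j : Fin n) → 1-cong (sym (*-assoc a b (b ^ toℕ j))))

  poch-+ : ∀ a b m n → poch a b (m ℕ.+ n) ≈ poch a b m * poch (a * b ^ m) b n
  poch-+ a b zero n = trans (poch-congˡ (sym (*-identityʳ a)) n) (sym (*-identityˡ _))
  poch-+ a b (suc m) n = begin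
    poch a b (suc (m ℕ.+ n))
      ≈⟨ poch-suc a b (m ℕ.+ n) ⟩
    (1# - a) * poch (a * b) b (m ℕ.+ n)
      ≈⟨ *-congˡ (poch-+ (a * b) b m n) ⟩
    (1# - a) * (poch (a * b) b m * poch (a * b * b ^ m) b n)
      ≈⟨ *-assoc _ _ _ ⟨
    ((1# - a) * poch (a * b) b m) * poch (a * b * b ^ m) b n
      ≈⟨ *-cong (sym (poch-suc a b m)) (poch-congˡ (*-assoc a b (b ^ m)) n) ⟩
    poch a b (suc m) * poch (a * b ^ suc m) b n ∎

  poch-last : ∀ a b n → poch a b (suc n) ≈ poch a b n * (1# - a * b ^ n)
  poch-last a b n = begin
    poch a b (suc n)                         ≡⟨ ≡.cong (poch a b) (ℕₚ.+-comm 1 n) ⟩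
    poch a b (n ℕ.+ 1)                       ≈⟨ poch-+ a b n 1 ⟩
    poch a b n * poch (a * b ^ n) b 1        ≈⟨ *-congˡ (*-identityʳ _) ⟩
    poch a b n * (1# - a * b ^ n * 1#)       ≈⟨ *-congˡ (1-cong (*-identityʳ _)) ⟩
    poch a b n * (1# - a * b ^ n)            ∎

-- Sums of f r d along the indices (r , d), (r + 1 , d - 2), (r + 2 , d - 4), …
-- with nonnegative second component.
module StrideSums (R : CommutativeRing c ℓ) where

  open CommutativeRing R hiding (zero)
  open RingDefs R
  open SetoidReasoning setoid

  strideSum : (ℕ → ℕ → Carrier) → ℕ → ℕ → Carrier
  strideSum f r zero          = f r 0
  strideSum f r (suc zero)    = f r 1
  strideSum f r (suc (suc d)) = f r (suc (suc d)) + strideSum f (suc r) d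

  -- Lowers the second index by one at fixed r, so that the sums for d + 1 and d can be compared
  -- summand by summand. The zero fills the additional last place that occurs when d + 1 is even.
  delay : (ℕ → ℕ → Carrier) → ℕ → ℕ → Carrier
  delay f r zero    = 0#
  delay f r (suc d) = f r d

  strideSum-delay : ∀ f r d → strideSum (delay f) r (suc d) ≈ strideSum f r d
  strideSum-delay f r zero          = refl
  strideSum-delay f r (suc zero)    = +-identityʳ _
  strideSum-delay f r (suc (suc d)) = +-congˡ (strideSum-delay f (suc r) d)

  strideSum-weight : ∀ (a : ℕ → ℕ → Carrier) f →
    (∀ r d → a r (suc (suc d)) ≈ a (suc r) d) →
    ∀ r d → strideSum (λ r d → a r d * f r d) r d ≈ a r d * strideSum f r d
  strideSum-weight a f h r zero          = refl
  strideSum-weight a f h r (suc zero)    = refl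
  strideSum-weight a f h r (suc (suc d)) = trans
    (+-congˡ (trans (strideSum-weight a f h (suc r) d) (*-congʳ (sym (h r d)))))
    (sym (distribˡ _ _ _))

  extend : (ℕ → Carrier) → ℤ → Carrier
  extend f (+ n)    = f n
  extend f -[1+ _ ] = 0#

  extend-cong : ∀ {f g} → (∀ n → f n ≈ g n) → ∀ z → extend f z ≈ extend g z
  extend-cong h (+ n)    = h n
  extend-cong h -[1+ _ ] = refl

  extend-scale : ∀ x f z → extend (λ n → x * f n) z ≈ x * extend f z
  extend-scale x f (+ n)    = refl
  extend-scale x f -[1+ _ ] = sym (zeroʳ x)

  ⊖2*-suc : ∀ d k → suc (suc d) ℤ.⊖ 2 ℕ.* suc k ≡ d ℤ.⊖ 2 ℕ.* k
  ⊖2*-suc d k = ≡.trans (≡.cong (suc (suc d) ℤ.⊖_) (ℕₚ.*-suc 2 k))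
    (≡.trans (ℤₚ.[1+m]⊖[1+n]≡m⊖n (suc d) (suc (2 ℕ.* k))) (ℤₚ.[1+m]⊖[1+n]≡m⊖n d (2 ℕ.* k)))

  1⊖2*-suc : ∀ k → 1 ℤ.⊖ 2 ℕ.* suc k ≡ -[1+ 2 ℕ.* k ]
  1⊖2*-suc k = ≡.trans (≡.cong (1 ℤ.⊖_) (ℕₚ.*-suc 2 k)) (ℤₚ.[1+m]⊖[1+n]≡m⊖n 0 (suc (2 ℕ.* k)))

  drop-2 : ∀ {d m} → suc (suc d) ℕ.< 2 ℕ.* suc m → d ℕ.< 2 ℕ.* m
  drop-2 {d} {m} h = ℕₚ.≤-pred (ℕₚ.≤-pred (≡.subst (suc (suc (suc d)) ℕ.≤_) (ℕₚ.*-suc 2 m) h))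

  open SemiringSum semiring using (sum-cong-≋; sum-replicate-zero)

  -- The bound on d puts every k with 2k ≤ d below m, so cutting the sum at the matrix size loses
  -- nothing. The offset `r` serves the induction.
  sum-extend : ∀ f r d m → d ℕ.< 2 ℕ.* m →
    sum (λ (k : Fin m) → extend (f (toℕ k ℕ.+ r)) (d ℤ.⊖ 2 ℕ.* toℕ k)) ≈ strideSum f r d
  sum-extend f r zero (suc m) _ =
    trans (+-congˡ (sum-replicate-zero m)) (+-identityʳ _)
  sum-extend f r (suc zero) (suc m) _ = trans (+-congˡ (trans
      (sum-cong-≋ λ (k : Fin m) → reflexive (≡.cong (extend (f (suc (toℕ k ℕ.+ r)))) (1⊖2*-suc (toℕ k))))
      (sum-replicate-zero m)))
    (+-identityʳ _)
  sum-extend f r (suc (suc d)) (suc m) d<2m = +-congˡ (trans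
    (sum-cong-≋ λ (k : Fin m) → reflexive (≡.cong₂ (λ s → extend (f s))
      (≡.sym (ℕₚ.+-suc (toℕ k) r)) (⊖2*-suc d (toℕ k))))
    (sum-extend f (suc r) d m (drop-2 d<2m)))

-- The q-Gauss sum in base q².

InverseQFactorials : (R : CommutativeRing c ℓ) (q : CommutativeRing.Carrier R)
  (e : ℕ → CommutativeRing.Carrier R) → Set ℓ
InverseQFactorials R q e = ∀ n → e n * poch q q n ≈ 1#
  where
  open CommutativeRing R
  open RingDefs R

module QSeries (R : CommutativeRing c ℓ) (q : CommutativeRing.Carrier R)
  (e : ℕ → CommutativeRing.Carrier R) (e-inverse : InverseQFactorials R q e) where

  open CommutativeRing R hiding (zero)
  open RingDefs R
  open IntegerCoefficients R
  open Pochhammer R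
  open StrideSums R
  open CommutativeSemiringExp commutativeSemiring using (^-assocʳ; ^-congˡ; ^-homo-*; ^-distrib-*)
  open SetoidReasoning setoid

  e-suc : ∀ n → e n ≈ (1# - q ^ suc n) * e (suc n)
  e-suc n = begin
    e n
      ≈⟨ *-identityʳ _ ⟨
    e n * 1#
      ≈⟨ *-congˡ (e-inverse (suc n)) ⟨
    e n * (e (suc n) * poch q q (suc n))
      ≈⟨ *-congˡ (*-congˡ (poch-last q q n)) ⟩
    e n * (e (suc n) * (poch q q n * (1# - q ^ suc n)))
      ≈⟨ solve 4 (λ a b p t → a :* (b :* (p :* t)) := (a :* p) :* (t :* b)) refl _ _ _ _ ⟩
    (e n * poch q q n) * ((1# - q ^ suc n) * e (suc n))
      ≈⟨ trans (*-congʳ (e-inverse n)) (*-identityˡ _) ⟩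
    (1# - q ^ suc n) * e (suc n) ∎

  inv : ℕ → Carrier
  inv n = e (suc n) * poch q q n

  inv-inverse : ∀ n → inv n * (1# - q ^ suc n) ≈ 1#
  inv-inverse n = begin
    e (suc n) * poch q q n * (1# - q ^ suc n)     ≈⟨ *-assoc _ _ _ ⟩
    e (suc n) * (poch q q n * (1# - q ^ suc n))   ≈⟨ *-congˡ (poch-last q q n) ⟨
    e (suc n) * poch q q (suc n)                  ≈⟨ e-inverse (suc n) ⟩
    1#                                            ∎

  -- As a power of q², q^(2r) makes `X (suc r)` unfold to `q ^ 2 * X r`, which the solver calls rely
  -- on.
  X : ℕ → Carrier
  X r = (q ^ 2) ^ r

  X-pow : ∀ r → X r ≈ q ^ (2 ℕ.* r)
  X-pow r = ^-assocʳ q 2 r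

  ^-split : ∀ r n → q ^ (2 ℕ.* suc r ℕ.+ n) ≈ q ^ suc n * q * X r
  ^-split r n = begin
    q ^ (2 ℕ.* suc r ℕ.+ n)             ≡⟨ ≡.cong (λ t → q ^ (t ℕ.+ n)) (ℕₚ.*-suc 2 r) ⟩
    q * (q * q ^ (2 ℕ.* r ℕ.+ n))       ≈⟨ *-congˡ (*-congˡ (^-homo-* q (2 ℕ.* r) n)) ⟩
    q * (q * (q ^ (2 ℕ.* r) * q ^ n))   ≈⟨ *-congˡ (*-congˡ (*-congʳ (X-pow r))) ⟨
    q * (q * (X r * q ^ n))             ≈⟨ solve 3 (λ q x y → q :* (q :* (x :* y)) := q :* y :* q :* x)
                                             refl q (X r) (q ^ n) ⟩
    q ^ suc n * q * X r                 ∎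

  -- ℓᵣ = (wq; q²)ᵣ (wq)ʳ q^{2r²-r} / (q²; q²)ᵣ
  coefficient : Carrier → ℕ → Carrier
  coefficient w zero    = 1#
  coefficient w (suc r) =
    (w * q ^ 2 * (X r * X r) * (1# - w * q * X r) * coefficient w r) * inv (ℕ.pred (2 ℕ.* suc r))

  coefficient-suc : ∀ w r → coefficient w (suc r) * (1# - X (suc r)) ≈
    w * q ^ 2 * (X r * X r) * (1# - w * q * X r) * coefficient w r
  coefficient-suc w r = begin
    coefficient w (suc r) * (1# - X (suc r))
      ≈⟨ *-congˡ (1-cong (X-pow (suc r))) ⟩
    coefficient w (suc r) * (1# - q ^ (2 ℕ.* suc r))
      ≈⟨ *-assoc _ _ _ ⟩
    (w * q ^ 2 * (X r * X r) * (1# - w * q * X r) * coefficient w r)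
      * (inv (ℕ.pred (2 ℕ.* suc r)) * (1# - q ^ (2 ℕ.* suc r)))
      -- `inv n` inverts 1 - q^(n+1), and the successor of this `pred` computes back to 2(r + 1).
      ≈⟨ *-congˡ (inv-inverse (ℕ.pred (2 ℕ.* suc r))) ⟩
    (w * q ^ 2 * (X r * X r) * (1# - w * q * X r) * coefficient w r) * 1#
      ≈⟨ *-identityʳ _ ⟩
    w * q ^ 2 * (X r * X r) * (1# - w * q * X r) * coefficient w r ∎

  base-q-entry : Carrier → ℕ → ℕ → Carrier
  base-q-entry w r d = poch (w * q * X r) q d * e d

  term : Carrier → ℕ → ℕ → Carrier
  term w r d = coefficient w r * base-q-entry w r d

  -- With n = d + 2r the two weights are 1 - q^n and 1 - w q^(2n+1), the coefficients of the
  -- recurrence (1 - q^(n+1)) S_{n+1} = (1 - w q^(2n+1)) S_n. As functions of (r, d) they can be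
  -- attached to single summands.
  weight₁ : ℕ → ℕ → Carrier
  weight₁ r d = 1# - q ^ d * X r

  weight₂ : Carrier → ℕ → ℕ → Carrier
  weight₂ w r d = 1# - w * q * ((q ^ d * X r) * (q ^ d * X r))

  -- q^{d+2r} is constant along a stride.
  stride-invariant : ∀ r d → q ^ suc (suc d) * X r ≈ q ^ d * X (suc r)
  stride-invariant r d = solve 3 (λ q y x → (q :* (q :* y)) :* x := y :* ((q :* (q :* con (+ 1))) :* x))
    refl q (q ^ d) (X r)

  -- The Wilf–Zeilberger certificate of the q-Gauss sum, in tail form: the last
  -- summand vanishes at r = 0, where X r = 1.
  telescope : ∀ w r d →
    strideSum (λ r d → weight₁ r d * term w r d) r d ≈
    strideSum (delay (λ r d → weight₂ w r d * term w r d)) r d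
      + q ^ d * ((1# - X r) * coefficient w r * (poch (w * X r) q d * e d))
  telescope w r zero = solve 3
    (λ x l e → (con (+ 1) :- con (+ 1) :* x) :* (l :* (con (+ 1) :* e))
      := con (+ 0) :+ con (+ 1) :* ((con (+ 1) :- x) :* l :* (con (+ 1) :* e)))
    refl (X r) (coefficient w r) (e 0)
  telescope w r (suc zero) = begin
    (1# - q * 1# * x) * (l * ((1# - w * q * x * 1#) * 1# * e 1))
      ≈⟨ solve 5 (λ w q x l e →
           (con (+ 1) :- q :* con (+ 1) :* x) :* (l :* ((con (+ 1) :- w :* q :* x :* con (+ 1)) :* con (+ 1) :* e))
           := (con (+ 1) :- w :* q :* ((con (+ 1) :* x) :* (con (+ 1) :* x)))
                :* (l :* (con (+ 1) :* ((con (+ 1) :- q :* con (+ 1)) :* e)))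
              :+ q :* con (+ 1) :* ((con (+ 1) :- x) :* l :* ((con (+ 1) :- w :* x :* con (+ 1)) :* con (+ 1) :* e)))
           refl w q x l (e 1) ⟩
    weight₂ w r 0 * (l * (1# * ((1# - q ^ 1) * e 1))) + remainder
      ≈⟨ +-congʳ (*-congˡ (*-congˡ (*-congˡ (e-suc 0)))) ⟨
    weight₂ w r 0 * (l * (1# * e 0)) + remainder ∎
    where
    x l remainder : Carrier
    x = X r
    l = coefficient w r
    remainder = q ^ 1 * ((1# - X r) * coefficient w r * (poch (w * X r) q 1 * e 1))
  telescope w r (suc (suc d)) = begin
    weight₁ r (2 ℕ.+ d) * term w r (2 ℕ.+ d)
      + strideSum (λ r d → weight₁ r d * term w r d) (suc r) d
      ≈⟨ +-congˡ (telescope w (suc r) d) ⟩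
    weight₁ r (2 ℕ.+ d) * term w r (2 ℕ.+ d) + (rest + remainder (suc r) d)
      ≈⟨ solve 3 (λ a b c → a :+ (b :+ c) := (a :+ c) :+ b) refl _ rest _ ⟩
    (weight₁ r (2 ℕ.+ d) * term w r (2 ℕ.+ d) + remainder (suc r) d) + rest
      -- The remainder from the tail joins the current summand. In terms of p = (w q^(2r+2); q)_d
      -- and E = 1/(q; q)_{d+2} the certificate is a polynomial identity in w, q, q^(2r), q^d.
      ≈⟨ +-congʳ (+-cong first-term next-remainder) ⟩
    ((1# - (q * (q * y)) * x) * (l * ((1# - w * q * x) * (p * (1# - w * q * x * q * y)) * E))
      + y * ((w * (q * (q * 1#)) * (x * x) * (1# - w * q * x) * l)
         * (p * ((1# - q * y) * ((1# - q * (q * y)) * E))))) + rest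
      ≈⟨ +-congʳ (solve 7 (λ w q x y l p E →
           (con (+ 1) :- (q :* (q :* y)) :* x)
             :* (l :* ((con (+ 1) :- w :* q :* x)
                  :* (p :* (con (+ 1) :- w :* q :* x :* q :* y)) :* E))
           :+ y :* ((w :* (q :* (q :* con (+ 1))) :* (x :* x) :* (con (+ 1) :- w :* q :* x) :* l)
                :* (p :* ((con (+ 1) :- q :* y) :* ((con (+ 1) :- q :* (q :* y)) :* E))))
           := (con (+ 1) :- w :* q :* (((q :* y) :* x) :* ((q :* y) :* x)))
                :* (l :* (((con (+ 1) :- w :* q :* x) :* p)
                     :* ((con (+ 1) :- q :* (q :* y)) :* E)))
              :+ (q :* (q :* y)) :* ((con (+ 1) :- x) :* l
                :* (((con (+ 1) :- w :* x) :* ((con (+ 1) :- w :* q :* x) :* p)) :* E)))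
           refl w q x y l p E) ⟩
    (weight₂ w r (suc d) * (l * (((1# - w * q * x) * p) * ((1# - q * (q * y)) * E)))
      + (q * (q * y)) * ((1# - x) * l * (((1# - w * x) * ((1# - w * q * x) * p)) * E))) + rest
      ≈⟨ +-congʳ (+-cong second-term this-remainder) ⟨
    (weight₂ w r (suc d) * term w r (suc d) + remainder r (2 ℕ.+ d)) + rest
      ≈⟨ solve 3 (λ a b c → (a :+ c) :+ b := (a :+ b) :+ c) refl _ rest _ ⟩
    (weight₂ w r (suc d) * term w r (suc d) + rest) + remainder r (2 ℕ.+ d) ∎
    where
    remainder : ℕ → ℕ → Carrier
    remainder r d = q ^ d * ((1# - X r) * coefficient w r * (poch (w * X r) q d * e d))
    x y l p E rest : Carrier
    x = X r
    y = q ^ d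
    l = coefficient w r
    p = poch (w * q * x * q) q d
    E = e (2 ℕ.+ d)
    rest = strideSum (delay (λ r d → weight₂ w r d * term w r d)) (suc r) d
    first-term : weight₁ r (2 ℕ.+ d) * term w r (2 ℕ.+ d) ≈
      (1# - (q * (q * y)) * x) * (l * ((1# - w * q * x) * (p * (1# - w * q * x * q * y)) * E))
    first-term = *-congˡ (*-congˡ (*-congʳ (trans
      (poch-suc (w * q * x) q (suc d)) (*-congˡ (poch-last (w * q * x * q) q d)))))
    second-term : weight₂ w r (suc d) * term w r (suc d) ≈
      weight₂ w r (suc d) * (l * (((1# - w * q * x) * p) * ((1# - q * (q * y)) * E)))
    second-term = *-congˡ (*-congˡ (*-cong (poch-suc (w * q * x) q d) (e-suc (suc d))))
    this-remainder : remainder r (2 ℕ.+ d) ≈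
      (q * (q * y)) * ((1# - x) * l * (((1# - w * x) * ((1# - w * q * x) * p)) * E))
    this-remainder = *-congˡ (*-congˡ (*-congʳ (begin
      poch (w * x) q (2 ℕ.+ d)
        ≈⟨ poch-suc (w * x) q (suc d) ⟩
      (1# - w * x) * poch (w * x * q) q (suc d)
        ≈⟨ *-congˡ (poch-congˡ (solve 3 (λ w x q → w :* x :* q := w :* q :* x) refl w x q) (suc d)) ⟩
      (1# - w * x) * poch (w * q * x) q (suc d)
        ≈⟨ *-congˡ (poch-suc (w * q * x) q d) ⟩
      (1# - w * x) * ((1# - w * q * x) * p) ∎)))
    next-remainder : remainder (suc r) d ≈
      y * ((w * (q * (q * 1#)) * (x * x) * (1# - w * q * x) * l)
         * (p * ((1# - q * y) * ((1# - q * (q * y)) * E))))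
    next-remainder = *-congˡ (*-cong
      -- The factor 1 - q^(2r+2) of the remainder clears the last denominator of ℓ_{r+1}.
      (trans (*-comm _ _) (coefficient-suc w r))
      (*-cong
        (poch-congˡ (solve 3 (λ w q x → w :* ((q :* (q :* con (+ 1))) :* x) := w :* q :* x :* q)
          refl w q x) d)
        (trans (e-suc d) (*-congˡ (e-suc (suc d))))))

  term-recurrence : ∀ w d → (1# - q ^ suc d) * strideSum (term w) 0 (suc d) ≈
    (1# - w * q * (q ^ d * q ^ d)) * strideSum (term w) 0 d
  term-recurrence w d = begin
    (1# - q ^ suc d) * strideSum (term w) 0 (suc d)
      ≈⟨ *-congʳ (1-cong (*-identityʳ _)) ⟨
    weight₁ 0 (suc d) * strideSum (term w) 0 (suc d)
      ≈⟨ strideSum-weight weight₁ (term w) (λ r d → 1-cong (stride-invariant r d)) 0 (suc d) ⟨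
    strideSum (λ r d → weight₁ r d * term w r d) 0 (suc d)
      ≈⟨ telescope w 0 (suc d) ⟩
    strideSum (delay (λ r d → weight₂ w r d * term w r d)) 0 (suc d)
      + q ^ suc d * ((1# - 1#) * 1# * (poch (w * 1#) q (suc d) * e (suc d)))
      ≈⟨ solve 3 (λ s y t → s :+ y :* ((con (+ 1) :- con (+ 1)) :* con (+ 1) :* t) := s)
           refl _ (q ^ suc d) (poch (w * 1#) q (suc d) * e (suc d)) ⟩
    strideSum (delay (λ r d → weight₂ w r d * term w r d)) 0 (suc d)
      ≈⟨ strideSum-delay (λ r d → weight₂ w r d * term w r d) 0 d ⟩
    strideSum (λ r d → weight₂ w r d * term w r d) 0 d
      ≈⟨ strideSum-weight (weight₂ w) (term w)
           (λ r d → 1-cong (*-congˡ (*-cong (stride-invariant r d) (stride-invariant r d)))) 0 d ⟩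
    weight₂ w 0 d * strideSum (term w) 0 d
      ≈⟨ *-congʳ (1-cong (*-congˡ (*-cong (*-identityʳ _) (*-identityʳ _)))) ⟩
    (1# - w * q * (q ^ d * q ^ d)) * strideSum (term w) 0 d ∎

  q²^ : ∀ d → (q ^ 2) ^ d ≈ q ^ d * q ^ d
  q²^ d = trans (^-congˡ d (*-congˡ (*-identityʳ q))) (^-distrib-* q q d)

  q-Gauss : ∀ w d → strideSum (term w) 0 d ≈ poch (w * q) (q ^ 2) d * e d
  q-Gauss w zero    = *-identityˡ _
  q-Gauss w (suc d) = begin
    strideSum (term w) 0 (suc d)
      ≈⟨ trans (*-congʳ (inv-inverse d)) (*-identityˡ _) ⟨
    inv d * (1# - q ^ suc d) * strideSum (term w) 0 (suc d)
      ≈⟨ trans (*-assoc _ _ _) (*-congˡ (term-recurrence w d)) ⟩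
    inv d * ((1# - w * q * (q ^ d * q ^ d)) * strideSum (term w) 0 d)
      ≈⟨ *-congˡ (*-cong (1-cong (*-congˡ (sym (q²^ d)))) (trans (q-Gauss w d) (*-congˡ (e-suc d)))) ⟩
    inv d * ((1# - w * q * (q ^ 2) ^ d) * (poch (w * q) (q ^ 2) d * ((1# - q ^ suc d) * e (suc d))))
      ≈⟨ solve 5 (λ i a p b e → i :* (a :* (p :* (b :* e))) := (i :* b) :* ((p :* a) :* e)) refl _ _ _ _ _ ⟩
    inv d * (1# - q ^ suc d) * (poch (w * q) (q ^ 2) d * (1# - w * q * (q ^ 2) ^ d) * e (suc d))
      ≈⟨ trans (*-congʳ (inv-inverse d)) (*-identityˡ _) ⟩
    poch (w * q) (q ^ 2) d * (1# - w * q * (q ^ 2) ^ d) * e (suc d)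
      ≈⟨ *-congʳ (poch-last (w * q) (q ^ 2) d) ⟨
    poch (w * q) (q ^ 2) (suc d) * e (suc d) ∎

-- The determinant identity over a ring with inverse q-factorials.

⊖≡+⇒≡+ : ∀ m n {d} → m ℤ.⊖ n ≡ + d → m ≡ n ℕ.+ d
⊖≡+⇒≡+ m       zero    e = ℤₚ.+-injective e
⊖≡+⇒≡+ zero    (suc n) ()
⊖≡+⇒≡+ (suc m) (suc n) e =
  ≡.cong suc (⊖≡+⇒≡+ m n (≡.trans (≡.sym (ℤₚ.[1+m]⊖[1+n]≡m⊖n m n)) e))

module QDeterminants (R : CommutativeRing c ℓ) (q : CommutativeRing.Carrier R)
  (e : ℕ → CommutativeRing.Carrier R) (e-inverse : InverseQFactorials R q e) where

  open CommutativeRing R hiding (zero)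
  open RingDefs R
  open IntegerCoefficients R
  open Pochhammer R
  open StrideSums R
  open QSeries R q e e-inverse
  open Determinants R
  open SemiringSum semiring using (sum-cong-≋)
  open CommutativeMonoidSum *-commutativeMonoid using () renaming
    (sum-cong-≋ to product-cong-≋; ∑-distrib-+ to product-distrib-*
    ; sum-replicate-zero to product-replicate-1)
  open SetoidReasoning setoid

  base-q²-entry : Carrier → ℕ → ℕ → Carrier
  base-q²-entry w r d = poch (w * q * X r) (q ^ 2) d * e d

  -- Entry (i, k) is ℓ_{k-i}(w q^(2i)) for k ≥ i. Recursion on the row, passing from w to w q²,
  -- matches the induction in `transition-row`.
  transition : ∀ {m} → Carrier → Matrix m
  transition w zero    k       = coefficient w (toℕ k)
  transition w (suc i) zero    = 0#
  transition w (suc i) (suc k) = transition (w * q ^ 2) i k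

  transition-upperUnitriangular : ∀ {m} w → UpperUnitriangular (transition {m} w)
  transition-upperUnitriangular w = record { diagonal = diagonal w ; below = below w }
    where
    diagonal : ∀ {m} w (i : Fin m) → transition w i i ≈ 1#
    diagonal w zero    = refl
    diagonal w (suc i) = diagonal (w * q ^ 2) i
    below : ∀ {m} w (i k : Fin m) → k Fin.< i → transition w i k ≈ 0#
    below w (suc i) zero    _         = refl
    below w (suc i) (suc k) (s≤s k<i) = below (w * q ^ 2) i k k<i

  shift-base : ∀ w r → w * q ^ 2 * q * X r ≈ w * q * X (suc r)
  shift-base w r = solve 4 (λ w p q x → w :* p :* q :* x := w :* q :* (p :* x)) refl w (q ^ 2) q (X r)

  transition-row : ∀ {m} w (i : Fin m) d → d ℕ.< 2 ℕ.* m →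
    extend (base-q²-entry w (toℕ i)) (d ℤ.⊖ 2 ℕ.* toℕ i) ≈
    sum λ k → transition w i k * extend (base-q-entry w (toℕ k)) (d ℤ.⊖ 2 ℕ.* toℕ k)
  transition-row {m} w zero d d<2m = begin
    poch (w * q * 1#) (q ^ 2) d * e d
      ≈⟨ *-congʳ (poch-congˡ (*-identityʳ (w * q)) d) ⟩
    poch (w * q) (q ^ 2) d * e d
      ≈⟨ q-Gauss w d ⟨
    strideSum (term w) 0 d
      ≈⟨ sum-extend (term w) 0 d m d<2m ⟨
    sum (λ (k : Fin m) → extend (term w (toℕ k ℕ.+ 0)) (d ℤ.⊖ 2 ℕ.* toℕ k))
      ≈⟨ sum-cong-≋ (λ (k : Fin m) → trans
           (reflexive (≡.cong (λ r → extend (term w r) (d ℤ.⊖ 2 ℕ.* toℕ k)) (ℕₚ.+-identityʳ (toℕ k))))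
           (extend-scale (coefficient w (toℕ k)) (base-q-entry w (toℕ k)) (d ℤ.⊖ 2 ℕ.* toℕ k))) ⟩
    sum (λ (k : Fin m) → coefficient w (toℕ k) * extend (base-q-entry w (toℕ k)) (d ℤ.⊖ 2 ℕ.* toℕ k)) ∎
  -- For d = 0 or 1 and a row below the first both sides vanish: column 0 of `transition` is 0
  -- there, and the other indices are negative.
  transition-row {suc m} w (suc i) zero _ = sym (trans
    (+-cong (zeroˡ _) (sum-zero {m} λ k → zeroʳ (transition (w * q ^ 2) i k)))
    (+-identityˡ 0#))
  transition-row {suc m} w (suc i) (suc zero) _ = trans
    (reflexive (≡.cong (extend (base-q²-entry w (suc (toℕ i)))) (1⊖2*-suc (toℕ i))))
    (sym (trans
      (+-cong (zeroˡ _) (sum-zero {m} λ k → trans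
        (*-congˡ {x = transition (w * q ^ 2) i k}
          (reflexive (≡.cong (extend (base-q-entry w (suc (toℕ k)))) (1⊖2*-suc (toℕ k)))))
        (zeroʳ _)))
      (+-identityˡ 0#)))
  transition-row {suc m} w (suc i) (suc (suc d)) d<2m = begin
    extend (base-q²-entry w (suc (toℕ i))) (2 ℕ.+ d ℤ.⊖ 2 ℕ.* suc (toℕ i))
      ≡⟨ ≡.cong (extend (base-q²-entry w (suc (toℕ i)))) (⊖2*-suc d (toℕ i)) ⟩
    extend (base-q²-entry w (suc (toℕ i))) (d ℤ.⊖ 2 ℕ.* toℕ i)
      ≈⟨ extend-cong (λ n → *-congʳ (poch-congˡ (shift-base w (toℕ i)) n)) (d ℤ.⊖ 2 ℕ.* toℕ i) ⟨
    extend (base-q²-entry (w * q ^ 2) (toℕ i)) (d ℤ.⊖ 2 ℕ.* toℕ i)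
      ≈⟨ transition-row (w * q ^ 2) i d (drop-2 d<2m) ⟩
    sum (λ k → transition (w * q ^ 2) i k * extend (base-q-entry (w * q ^ 2) (toℕ k)) (d ℤ.⊖ 2 ℕ.* toℕ k))
      ≈⟨ sum-cong-≋ (λ k → *-congˡ {x = transition (w * q ^ 2) i k} (trans
           (extend-cong (λ n → *-congʳ (poch-congˡ (shift-base w (toℕ k)) n)) (d ℤ.⊖ 2 ℕ.* toℕ k))
           (reflexive (≡.cong (extend (base-q-entry w (suc (toℕ k)))) (≡.sym (⊖2*-suc d (toℕ k))))))) ⟩
    sum (λ k → transition (w * q ^ 2) i k
      * extend (base-q-entry w (suc (toℕ k))) (2 ℕ.+ d ℤ.⊖ 2 ℕ.* suc (toℕ k)))
      ≈⟨ trans (+-congʳ (zeroˡ _)) (+-identityˡ _) ⟨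
    0# * extend (base-q-entry w 0) (2 ℕ.+ d ℤ.⊖ 0) + sum (λ k → transition (w * q ^ 2) i k
      * extend (base-q-entry w (suc (toℕ k))) (2 ℕ.+ d ℤ.⊖ 2 ℕ.* suc (toℕ k))) ∎

  -- The prefactor completes (w q^(2k+1); q)_{d-2k} to (wq; q)_d, which is the same in all rows; for
  -- 2k > d both entries are 0 by convention.
  base-q-entry-rescale : ∀ w k d →
    poch (w * q) q (2 ℕ.* k) * extend (base-q-entry w k) (d ℤ.⊖ 2 ℕ.* k) ≈
    poch (w * q) q d * extend e (d ℤ.⊖ 2 ℕ.* k)
  base-q-entry-rescale w k d with d ℤ.⊖ 2 ℕ.* k in eq
  ... | -[1+ _ ] = trans (zeroʳ _) (sym (zeroʳ _))
  ... | + n = begin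
    poch (w * q) q (2 ℕ.* k) * (poch (w * q * X k) q n * e n)
      ≈⟨ *-assoc _ _ _ ⟨
    poch (w * q) q (2 ℕ.* k) * poch (w * q * X k) q n * e n
      ≈⟨ *-congʳ (*-congˡ (poch-congˡ (*-congˡ (X-pow k)) n)) ⟩
    poch (w * q) q (2 ℕ.* k) * poch (w * q * q ^ (2 ℕ.* k)) q n * e n
      ≈⟨ *-congʳ (poch-+ (w * q) q (2 ℕ.* k) n) ⟨
    poch (w * q) q (2 ℕ.* k ℕ.+ n) * e n
      ≡⟨ ≡.cong (λ t → poch (w * q) q t * e n) (⊖≡+⇒≡+ d (2 ℕ.* k) eq) ⟨
    poch (w * q) q d * e n ∎

  -- (q; q)_s completes (q^(s+1); q)_n to (q; q)_{s+n}, whose inverse is given. This is where w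
  -- enters as a power of q.
  poch-unit : ∀ s n → ∃ λ y → y * poch (q ^ s * q) q n ≈ 1#
  poch-unit s n = e (s ℕ.+ n) * poch q q s , (begin
    e (s ℕ.+ n) * poch q q s * poch (q ^ s * q) q n
      ≈⟨ *-congˡ (poch-congˡ (*-comm (q ^ s) q) n) ⟩
    e (s ℕ.+ n) * poch q q s * poch (q * q ^ s) q n
      ≈⟨ *-assoc _ _ _ ⟩
    e (s ℕ.+ n) * (poch q q s * poch (q * q ^ s) q n)
      ≈⟨ *-congˡ (poch-+ q q s n) ⟨
    e (s ℕ.+ n) * poch q q (s ℕ.+ n)
      ≈⟨ e-inverse (s ℕ.+ n) ⟩
    1# ∎)

  product-unit : ∀ {n} (f : Vector Carrier n) → (∀ i → ∃ λ y → y * f i ≈ 1#) →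
    ∃ λ y → y * product f ≈ 1#
  product-unit {n} f h = product (proj₁ ∘ h) , (begin
    product (proj₁ ∘ h) * product f       ≈⟨ product-distrib-* (proj₁ ∘ h) f ⟨
    product (λ i → proj₁ (h i) * f i)     ≈⟨ product-cong-≋ (proj₂ ∘ h) ⟩
    product (λ (i : Fin n) → 1#)          ≈⟨ product-replicate-1 n ⟩
    1#                                    ∎)

  unit-cancel : ∀ {u} → (∃ λ y → y * u ≈ 1#) → ∀ {a b} → u * a ≈ u * b → a ≈ b
  unit-cancel {u} (y , yu≈1) {a} {b} h = begin
    a              ≈⟨ *-identityˡ a ⟨
    1# * a         ≈⟨ *-congʳ yu≈1 ⟨
    y * u * a      ≈⟨ trans (*-assoc y u a) (*-congˡ h) ⟩
    y * (u * b)    ≈⟨ *-assoc y u b ⟨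
    y * u * b      ≈⟨ *-congʳ yu≈1 ⟩
    1# * b         ≈⟨ *-identityˡ b ⟩
    b              ∎

  det-base-q² : ∀ {m} s (d : Vector ℕ m) → (∀ j → d j ℕ.< 2 ℕ.* m) → (∀ j → 2 ℕ.* toℕ j ℕ.≤ d j) →
    det {m} (λ i j → extend (base-q²-entry (q ^ s) (toℕ i)) (d j ℤ.⊖ 2 ℕ.* toℕ i)) ≈
    product (λ (k : Fin m) → poch (q ^ s * q * X (toℕ k)) q (d k ℕ.∸ 2 ℕ.* toℕ k))
      * det {m} (λ i j → extend e (d j ℤ.⊖ 2 ℕ.* toℕ i))
  det-base-q² {m} s d d<2m 2j≤d = begin
    det M
      ≈⟨ det-upperUnitriangular-* (transition-upperUnitriangular w)
           (λ i j → transition-row w i (d j) (d<2m j)) ⟩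
    det N
      ≈⟨ unit-cancel (product-unit P λ k → poch-unit s (2 ℕ.* toℕ k)) (begin
           product P * det N
             ≈⟨ det-scaleRows P N ⟨
           det (λ i j → P i * N i j)
             ≈⟨ det-cong (λ i j → base-q-entry-rescale w (toℕ i) (d j)) ⟩
           det (λ i j → C j * S i j)
             ≈⟨ det-scaleColumns C S ⟩
           product C * det S
             ≈⟨ *-congʳ (trans (product-cong-≋ split) (product-distrib-* P W)) ⟩
           product P * product W * det S
             ≈⟨ *-assoc _ _ _ ⟩
           product P * (product W * det S) ∎) ⟩
    product W * det S ∎
    where
    w : Carrier
    w = q ^ s
    M N S : Matrix m
    M i j = extend (base-q²-entry w (toℕ i)) (d j ℤ.⊖ 2 ℕ.* toℕ i)
    N i j = extend (base-q-entry w (toℕ i)) (d j ℤ.⊖ 2 ℕ.* toℕ i)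
    S i j = extend e (d j ℤ.⊖ 2 ℕ.* toℕ i)
    P C W : Vector Carrier m
    P k = poch (w * q) q (2 ℕ.* toℕ k)
    C k = poch (w * q) q (d k)
    W k = poch (w * q * X (toℕ k)) q (d k ℕ.∸ 2 ℕ.* toℕ k)
    -- Since 2k ≤ d_k, the factor of column k contains that of row k; the quotient becomes the k-th
    -- factor of the theorem.
    split : ∀ k → C k ≈ P k * W k
    split k = begin
      poch (w * q) q (d k)
        ≡⟨ ≡.cong (poch (w * q) q) (ℕₚ.m+[n∸m]≡n (2j≤d k)) ⟨
      poch (w * q) q (2 ℕ.* toℕ k ℕ.+ (d k ℕ.∸ 2 ℕ.* toℕ k))
        ≈⟨ poch-+ (w * q) q (2 ℕ.* toℕ k) _ ⟩
      P k * poch (w * q * q ^ (2 ℕ.* toℕ k)) q (d k ℕ.∸ 2 ℕ.* toℕ k)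
        ≈⟨ *-congˡ {x = P k} (poch-congˡ (*-congˡ (X-pow (toℕ k))) (d k ℕ.∸ 2 ℕ.* toℕ k)) ⟨
      P k * W k ∎

-- Embedding a domain into its field of fractions.

module FractionEmbedding (R : CommutativeRing c ℓ)
  (1≉0 : Nontrivial R) (integral : NoZeroDivisors R) where

  open CommutativeRing R hiding (zero)
  open Fractions R 1≉0 integral
  open IntegerCoefficients R

  private
    module K = CommutativeRing fractionField
    module PR = RingDefs R
    module PK = RingDefs fractionField

  ι-+ : ∀ x y → ι (x + y) ≃ ι x ⊕ ι y
  ι-+ x y = mk≃ (solve 2 (λ x y → (x :+ y) :* (con (+ 1) :* con (+ 1))
    := (x :* con (+ 1) :+ y :* con (+ 1)) :* con (+ 1)) refl x y)

  ι-* : ∀ x y → ι (x * y) ≃ ι x ⊗ ι y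
  ι-* x y = mk≃ (*-congˡ (*-identityˡ 1#))

  ι-^ : ∀ x n → ι (x PR.^ n) ≃ ι x PK.^ n
  ι-^ x zero    = ≃-refl
  ι-^ x (suc n) = ≃-trans (ι-* x (x PR.^ n)) (⊗-cong (≃-refl {ι x}) (ι-^ x n))

  ι-product : ∀ {n} (f : Vector Carrier n) → ι (PR.product f) ≃ PK.product (ι ∘ f)
  ι-product {zero}  f = ≃-refl
  ι-product {suc n} f = ≃-trans (ι-* _ _) (⊗-cong (≃-refl {ι (head f)}) (ι-product (tail f)))

  ι-poch : ∀ a b n → ι (PR.poch a b n) ≃ PK.poch (ι a) (ι b) n
  ι-poch a b n = ≃-trans (ι-product λ (j : Fin n) → 1# - a * b PR.^ toℕ j) (product-cong-≋ λ (j : Fin n) →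
    ≃-trans (ι-+ 1# _) (⊕-cong (≃-refl {ι 1#}) (⊖-cong
      (≃-trans (ι-* a (b PR.^ toℕ j)) (⊗-cong (≃-refl {ι a}) (ι-^ b (toℕ j)))))))
    where
    open CommutativeMonoidSum K.*-commutativeMonoid
      using () renaming (sum-cong-≋ to product-cong-≋)

  -- Separates the numerator, which the homomorphism `ι` carries over, from 1/(q; q)_n, which takes
  -- the role of e_n.
  frac≃ι⊗ : ∀ p d d≉0 → frac p d d≉0 ≃ ι p ⊗ frac 1# d d≉0
  frac≃ι⊗ p d d≉0 = mk≃ (solve 2 (λ p d → p :* (con (+ 1) :* d) := p :* con (+ 1) :* d) refl p d)

  frac⊗ι : ∀ d d≉0 → frac 1# d d≉0 ⊗ ι d ≃ ι 1#
  frac⊗ι d d≉0 = mk≃ (solve 1 (λ d → con (+ 1) :* d :* con (+ 1) := con (+ 1) :* (d :* con (+ 1))) refl d)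

-- Specialisation to rational functions and admissible sequences.

open CommutativeRing ℚ⟨q⟩ hiding (zero)

module ι = FractionEmbedding ℤ[q] Polynomials.1≉0 Polynomials.integral

ιq : Carrier
ιq = Frac.ι q

1/qfac : ℕ → Carrier
1/qfac n = Polynomials.1ₚ /qfac n

1/qfac-inverse : InverseQFactorials ℚ⟨q⟩ ιq 1/qfac
1/qfac-inverse n = trans (*-congˡ {1/qfac n} (sym (ι.ι-poch q q n))) (ι.frac⊗ι (qfac n) (qfac≉0 n))

open Pochhammer ℚ⟨q⟩ using (poch-cong)
open StrideSums ℚ⟨q⟩ using (extend; ⊖2*-suc)
open QSeries ℚ⟨q⟩ ιq 1/qfac 1/qfac-inverse using (X; ^-split)
open QDeterminants ℚ⟨q⟩ ιq 1/qfac 1/qfac-inverse using (base-q²-entry; det-base-q²)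
open Determinants ℚ⟨q⟩ using (det-cong)
open CommutativeMonoidSum *-commutativeMonoid
  using () renaming (sum-cong-≋ to product-cong-≋)

-- For n = 2x this explains w = q^(2x+1): in the one-based row i + 1 the exponent 2(i + 1) + 2x is
-- that of w q q^(2i).
ι-base : ∀ i n → Frac.ι (q P.^ (2 ℕ.* suc i ℕ.+ n)) ≈ ιq Q.^ suc n * ιq * X i
ι-base i n = trans (ι.ι-^ q (2 ℕ.* suc i ℕ.+ n)) (^-split i n)

mEntry≈ : ∀ i x z → mEntry (suc i) x z ≈ extend (base-q²-entry (ιq Q.^ suc (2 ℕ.* x)) i) z
mEntry≈ i x -[1+ _ ] = refl
mEntry≈ i x (+ n)    = trans
  (ι.frac≃ι⊗ (P.poch (q P.^ (2 ℕ.* suc i ℕ.+ 2 ℕ.* x)) (q P.^ 2) n) (qfac n) (qfac≉0 n))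
  (*-congʳ {1/qfac n} (trans (ι.ι-poch (q P.^ (2 ℕ.* suc i ℕ.+ 2 ℕ.* x)) (q P.^ 2) n)
    (poch-cong (ι-base i (2 ℕ.* x)) (ι.ι-^ q 2) n)))

sEntry≈ : ∀ z → sEntry z ≈ extend 1/qfac z
sEntry≈ (+ n)    = refl
sEntry≈ -[1+ _ ] = refl

-- The bound 2k + 1 ≤ z makes z positive, so z - 1 is a natural number; the zero-based columns are
-- indexed by a_j - 1.
degree : ∀ k z → + (2 ℕ.* suc k) ℤ.- + 1 ℤ.≤ z → ∃ λ d → z ≡ + suc d × 2 ℕ.* k ℕ.≤ d
degree k (+ n)    (ℤ.+≤+ h) with ≡.subst (ℕ._≤ n) (ℕₚ.+-suc k (k ℕ.+ 0)) h
... | s≤s 2k≤d = _ , ≡.refl , 2k≤d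

suc+1⊖2*suc : ∀ d k → + suc d ℤ.+ + 1 ℤ.- + (2 ℕ.* suc k) ≡ d ℤ.⊖ 2 ℕ.* k
suc+1⊖2*suc d k = ≡.trans (≡.cong (λ t → + suc t ℤ.- + (2 ℕ.* suc k)) (ℕₚ.+-comm d 1)) (⊖2*-suc d k)

suc⊖2*suc+1 : ∀ d k → 2 ℕ.* k ℕ.≤ d → + suc d ℤ.- + (2 ℕ.* suc k) ℤ.+ + 1 ≡ + (d ℕ.∸ 2 ℕ.* k)
suc⊖2*suc+1 d k 2k≤d = begin
  + suc d ℤ.- b ℤ.+ + 1         ≡⟨ ℤₚ.+-assoc (+ suc d) (ℤ.- b) (+ 1) ⟩
  + suc d ℤ.+ (ℤ.- b ℤ.+ + 1)   ≡⟨ ≡.cong (λ t → + suc d ℤ.+ t) (ℤₚ.+-comm (ℤ.- b) (+ 1)) ⟩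
  + suc d ℤ.+ (+ 1 ℤ.- b)       ≡⟨ ℤₚ.+-assoc (+ suc d) (+ 1) (ℤ.- b) ⟨
  + suc d ℤ.+ + 1 ℤ.- b         ≡⟨ suc+1⊖2*suc d k ⟩
  d ℤ.⊖ 2 ℕ.* k                 ≡⟨ ℤₚ.⊖-≥ 2k≤d ⟩
  + (d ℕ.∸ 2 ℕ.* k)             ∎
  where
  open ≡.≡-Reasoning
  b : ℤ
  b = + (2 ℕ.* suc k)

theorem1 : ∀ (m : ℕ) → m ≥ 1 → (a : Vector ℤ m) → Admissible a → (x : ℕ) →
    Q.det (mMatrix a x) ≈ Q.product (rowFactor a x) * Q.det (sMatrix a)
theorem1 m _ a adm x = begin
  Q.det (mMatrix a x)
    ≈⟨ det-cong (λ i j → trans (mEntry≈ (toℕ i) x (shift a i j))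
         (reflexive (≡.cong (extend (base-q²-entry w (toℕ i))) (shift≡ i j)))) ⟩
  Q.det (λ i j → extend (base-q²-entry w (toℕ i)) (d j ℤ.⊖ 2 ℕ.* toℕ i))
    ≈⟨ det-base-q² (suc (2 ℕ.* x)) d d<2m 2j≤d ⟩
  Q.product (λ k → Q.poch (w * ιq * X (toℕ k)) ιq (d k ℕ.∸ 2 ℕ.* toℕ k))
    * Q.det (λ i j → extend 1/qfac (d j ℤ.⊖ 2 ℕ.* toℕ i))
    ≈⟨ *-cong (product-cong-≋ factor) (det-cong (λ i j → trans (sEntry≈ (shift a i j))
         (reflexive (≡.cong (extend 1/qfac) (shift≡ i j))))) ⟨
  Q.product (rowFactor a x) * Q.det (sMatrix a) ∎
  where
  open SetoidReasoning setoid
  open Admissible adm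
  w : Carrier
  w = ιq Q.^ suc (2 ℕ.* x)
  d : Vector ℕ m
  d j = proj₁ (degree (toℕ j) (a j) (lower j))
  a≡ : ∀ j → a j ≡ + suc (d j)
  a≡ j = proj₁ (proj₂ (degree (toℕ j) (a j) (lower j)))
  2j≤d : ∀ j → 2 ℕ.* toℕ j ℕ.≤ d j
  2j≤d j = proj₂ (proj₂ (degree (toℕ j) (a j) (lower j)))
  d<2m : ∀ j → d j ℕ.< 2 ℕ.* m
  -- a_j ≤ 2m reads d_j + 1 ≤ 2m, which is the strict bound on d_j.
  d<2m j = ℤₚ.drop‿+≤+ (≡.subst (ℤ._≤ + (2 ℕ.* m)) (a≡ j) (upper j))
  shift≡ : ∀ i j → shift a i j ≡ d j ℤ.⊖ 2 ℕ.* toℕ i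
  shift≡ i j = ≡.trans (≡.cong (λ t → t ℤ.+ + 1 ℤ.- + (2 ℕ.* pos i)) (a≡ j)) (suc+1⊖2*suc (d j) (toℕ i))
  length≡ : ∀ k → ℤ.∣ a k ℤ.- + (2 ℕ.* pos k) ℤ.+ + 1 ∣ ≡ d k ℕ.∸ 2 ℕ.* toℕ k
  length≡ k = ≡.cong ℤ.∣_∣ (≡.trans (≡.cong (λ t → t ℤ.- + (2 ℕ.* pos k) ℤ.+ + 1) (a≡ k))
    (suc⊖2*suc+1 (d k) (toℕ k) (2j≤d k)))
  factor : ∀ k → rowFactor a x k ≈ Q.poch (w * ιq * X (toℕ k)) ιq (d k ℕ.∸ 2 ℕ.* toℕ k)
  factor k = begin
    rowFactor a x k
      ≡⟨ ≡.cong₂ (λ s n → Frac.ι (P.poch (q P.^ s) q n)) (ℕₚ.+-comm (2 ℕ.* x) (2 ℕ.* pos k)) (length≡ k) ⟩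
    Frac.ι (P.poch (q P.^ (2 ℕ.* pos k ℕ.+ 2 ℕ.* x)) q (d k ℕ.∸ 2 ℕ.* toℕ k))
      ≈⟨ ι.ι-poch (q P.^ (2 ℕ.* pos k ℕ.+ 2 ℕ.* x)) q (d k ℕ.∸ 2 ℕ.* toℕ k) ⟩
    Q.poch (Frac.ι (q P.^ (2 ℕ.* pos k ℕ.+ 2 ℕ.* x))) ιq (d k ℕ.∸ 2 ℕ.* toℕ k)
      ≈⟨ poch-cong (ι-base (toℕ k) (2 ℕ.* x)) refl (d k ℕ.∸ 2 ℕ.* toℕ k) ⟩
    Q.poch (w * ιq * X (toℕ k)) ιq (d k ℕ.∸ 2 ℕ.* toℕ k) ∎
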